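{- Let $n\ge 5$ and let $\Gamma=(G,\sigma)$ be an unbalanced signed graph of order $n$. If $\lambda_1(\Gamma)\ge \lambda_1(\Gamma_1)$, where $\Gamma_1$ is the signed graph on $n$ vertices defined in the context, then $\Gamma$ contains a negative $C_4$ (a negative cycle of length $4$) as a subgraph, unless $\Gamma$ is switching equivalent to $\Gamma_1$.
   Context: All graphs are finite and simple. A signed graph $\Gamma=(G,\sigma)$ consists of a graph $G=(V(G),E(G))$ and a sign function $\sigma:E(G)\to\{ -1,1\}$; its order is $|V(G)|$. An edge $e$ is positive if $\sigma(e)=1$ and negative if $\sigma(e)=-1$. A cycle in $\Gamma$ (a cycle of $G$, with edge signs inherited from $\sigma$) is positive if it has an even number of negative edges and negative if it has an odd number of negative edges. $\Gamma$ is balanced if all its cycles are positive, and unbalanced otherwise. "Contains as a subgraph" refers to not necessarily induced subgraphs. The adjacency matrix $A(\Gamma)=(a^\sigma_{ij})$ has $a^\sigma_{ij}=\sigma(v_iv_j)$ if $v_i$ and $v_j$ are adjacent in $G$, and $a^\sigma_{ij}=0$ otherwise. $\lambda_1(\Gamma)$ denotes the largest eigenvalue of $A(\Gamma)$ (the index of $\Gamma$). For $U\subset V(G)$, the switching operation with respect to $U$ changes the sign of every edge between $U$ and $V(G)\setminus U$. Two signed graphs are switching equivalent if one is obtained from the other by finitely many switching operations. Signed graphs are considered up to (sign-preserving) isomorphism, so "$\Gamma$ is switching equivalent to $\Gamma_1$" means that $\Gamma$ is switching equivalent to a signed graph isomorphic to $\Gamma_1$. Definition of $\Gamma_1$ (for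 $n\ge5$): its vertices are $v_1,\dots,v_n$. The vertices $v_3,v_4,\dots,v_n$ induce a complete graph $K_{n-2}$ with all edges positive; the edges $v_1v_3$ and $v_2v_3$ are positive; the edge $v_1v_2$ is negative; there are no other edges. -}

module Defs where

open import Data.Bool using (true; if_then_else_; _xor_)
open import Data.Fin using (Fin; toℕ)
open import Data.Fin.Permutation using (Permutation′; _⟨$⟩ʳ_)
open import Data.Fin.Subset using (Subset)
open import Data.List using (allFin; filter; length)
open import Data.Maybe using (Maybe; just; nothing; Is-just)
import Data.Maybe as Maybe
open import Data.Maybe.Properties using (≡-dec)
open import Data.Nat as ℕ using (ℕ; zero; suc; NonZero)
import Data.Nat.Properties as ℕ
open import Data.Nat.Divisibility using (_∣_)
open import Data.Nat.DivMod using (_mod_)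
open import Data.Product using (∃; ∃-syntax; _×_; _,_)
open import Data.Rational as ℚ using (ℚ; 0ℚ; 1ℚ; ½; ∣_∣; _<_)
import Data.Rational.Properties as ℚ
open import Data.Rational.Solver using (module +-*-Solver)
open import Data.Sign using (Sign; opposite)
import Data.Sign.Properties as Sign
import Data.Vec as Vec
open import Data.Vec.Functional using (Vector; foldr)
open import Function.Definitions using (Injective)
open import Relation.Binary.Construct.Closure.ReflexiveTransitive using (Star)
open import Relation.Binary.PropositionalEquality
open import Relation.Nullary using (¬_)

-- Real numbers are Cauchy sequences of rationals, taken up to _≈_; the
-- operations act termwise.
record ℝ : Set where
  constructor mkℝ
  field
    seq    : ℕ → ℚ
    cauchy : ∀ ε → 0ℚ < ε → ∃[ N ] ∀ m n → N ℕ.≤ m → N ℕ.≤ n →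
             ∣ seq m ℚ.- seq n ∣ < ε

open ℝ

infix  4 _≈_ _≤_
infixl 6 _+_
infixl 7 _*_
infix  8 -_

_≈_ : ℝ → ℝ → Set
x ≈ y = ∀ ε → 0ℚ < ε → ∃[ N ] ∀ n → N ℕ.≤ n → ∣ seq x n ℚ.- seq y n ∣ < ε

_≤_ : ℝ → ℝ → Set
x ≤ y = ∀ ε → 0ℚ < ε → ∃[ N ] ∀ n → N ℕ.≤ n → seq x n < seq y n ℚ.+ ε

fromℚ : ℚ → ℝ
fromℚ q = mkℝ (λ _ → q) λ ε 0<ε → 0 , λ _ _ _ _ →
  subst (_< ε) (sym (cong ∣_∣ (ℚ.+-inverseʳ q))) 0<ε

0ℝ 1ℝ : ℝ
0ℝ = fromℚ 0ℚ
1ℝ = fromℚ 1ℚ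

private
  0<½* : ∀ {ε} → 0ℚ < ε → 0ℚ < ½ ℚ.* ε
  0<½* {ε} 0<ε = subst (_< ½ ℚ.* ε) (ℚ.*-zeroʳ ½) (ℚ.*-monoʳ-<-pos ½ 0<ε)

  ½+½ : ∀ ε → ½ ℚ.* ε ℚ.+ ½ ℚ.* ε ≡ ε
  ½+½ ε = trans (sym (ℚ.*-distribʳ-+ ε ½ ½)) (ℚ.*-identityˡ ε)

  eventuallyBounded : ∀ x → ∃[ B ] 0ℚ < B × ∃[ N ] ∀ n → N ℕ.≤ n → ∣ seq x n ∣ < B
  eventuallyBounded x with cauchy x 1ℚ (ℚ.positive⁻¹ 1ℚ)
  ... | N , close = B , ℚ.≤-<-trans (ℚ.0≤∣p∣ (seq x N)) (bound N ℕ.≤-refl) , N , bound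
    where
    B = 1ℚ ℚ.+ ∣ seq x N ∣
    bound : ∀ n → N ℕ.≤ n → ∣ seq x n ∣ < B
    bound n N≤n = begin-strict
      ∣ seq x n ∣
        ≡⟨ cong ∣_∣ (solve 2 (λ a b → a := (a :- b) :+ b) refl (seq x n) (seq x N)) ⟩
      ∣ (seq x n ℚ.- seq x N) ℚ.+ seq x N ∣
        ≤⟨ ℚ.∣p+q∣≤∣p∣+∣q∣ (seq x n ℚ.- seq x N) (seq x N) ⟩
      ∣ seq x n ℚ.- seq x N ∣ ℚ.+ ∣ seq x N ∣
        <⟨ ℚ.+-monoˡ-< ∣ seq x N ∣ (close n N N≤n ℕ.≤-refl) ⟩
      B ∎
      where open ℚ.≤-Reasoning
            open +-*-Solver

  -- A positive δ with δ * B = ε / 2.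
  split : ∀ B ε → 0ℚ < B → 0ℚ < ε → ∃[ δ ] 0ℚ < δ × δ ℚ.* B ≡ ½ ℚ.* ε
  split B ε 0<B 0<ε =
    let instance
          B⁺   = ℚ.positive 0<B
          B≢0  = ℚ.pos⇒nonZero B
          B⁻¹⁺ = ℚ.1/pos⇒pos B
          ½ε⁺  = ℚ.positive (0<½* 0<ε)
          δ⁺   = ℚ.pos*pos⇒pos (½ ℚ.* ε) (ℚ.1/ B)
        open ≡-Reasoning
    in ½ ℚ.* ε ℚ.* ℚ.1/ B , ℚ.positive⁻¹ (½ ℚ.* ε ℚ.* ℚ.1/ B) , (begin
      ½ ℚ.* ε ℚ.* ℚ.1/ B ℚ.* B    ≡⟨ ℚ.*-assoc (½ ℚ.* ε) (ℚ.1/ B) B ⟩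
      ½ ℚ.* ε ℚ.* (ℚ.1/ B ℚ.* B)  ≡⟨ cong (½ ℚ.* ε ℚ.*_) (ℚ.*-inverseˡ B) ⟩
      ½ ℚ.* ε ℚ.* 1ℚ              ≡⟨ ℚ.*-identityʳ (½ ℚ.* ε) ⟩
      ½ ℚ.* ε                     ∎)

  *-bound : ∀ p q {δ B} → 0ℚ < B → ∣ p ∣ < δ → ∣ q ∣ < B → ∣ p ℚ.* q ∣ < δ ℚ.* B
  *-bound p q {δ} {B} 0<B p<δ q<B = begin-strict
    ∣ p ℚ.* q ∣      ≡⟨ ℚ.∣p*q∣≡∣p∣*∣q∣ p q ⟩
    ∣ p ∣ ℚ.* ∣ q ∣  ≤⟨ ℚ.*-monoˡ-≤-nonNeg ∣ p ∣ (ℚ.<⇒≤ q<B) ⟩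
    ∣ p ∣ ℚ.* B      <⟨ ℚ.*-monoˡ-<-pos B p<δ ⟩
    δ ℚ.* B          ∎
    where
    open ℚ.≤-Reasoning
    instance
      B⁺ = ℚ.positive 0<B
      p⁺ = ℚ.nonNegative (ℚ.0≤∣p∣ p)

  *-estimate : ∀ a b c d {δ B δ′ B′} → 0ℚ < B → 0ℚ < B′ →
               ∣ a ℚ.- c ∣ < δ → ∣ b ∣ < B → ∣ b ℚ.- d ∣ < δ′ → ∣ c ∣ < B′ →
               ∣ a ℚ.* b ℚ.- c ℚ.* d ∣ < δ ℚ.* B ℚ.+ δ′ ℚ.* B′
  *-estimate a b c d {δ} {B} {δ′} {B′} 0<B 0<B′ a-c<δ b<B b-d<δ′ c<B′ = begin-strict
    ∣ a ℚ.* b ℚ.- c ℚ.* d ∣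
      ≡⟨ cong ∣_∣ (solve 4 (λ a b c d → a :* b :- c :* d := (a :- c) :* b :+ (b :- d) :* c)
                     refl a b c d) ⟩
    ∣ (a ℚ.- c) ℚ.* b ℚ.+ (b ℚ.- d) ℚ.* c ∣
      ≤⟨ ℚ.∣p+q∣≤∣p∣+∣q∣ ((a ℚ.- c) ℚ.* b) ((b ℚ.- d) ℚ.* c) ⟩
    ∣ (a ℚ.- c) ℚ.* b ∣ ℚ.+ ∣ (b ℚ.- d) ℚ.* c ∣
      <⟨ ℚ.+-mono-< (*-bound (a ℚ.- c) b 0<B a-c<δ b<B)
                    (*-bound (b ℚ.- d) c 0<B′ b-d<δ′ c<B′) ⟩
    δ ℚ.* B ℚ.+ δ′ ℚ.* B′ ∎
    where open ℚ.≤-Reasoning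
          open +-*-Solver

_+_ : ℝ → ℝ → ℝ
x + y = mkℝ (λ n → seq x n ℚ.+ seq y n) +-cauchy
  where
  +-cauchy : ∀ ε → 0ℚ < ε → ∃[ N ] ∀ m n → N ℕ.≤ m → N ℕ.≤ n →
             ∣ (seq x m ℚ.+ seq y m) ℚ.- (seq x n ℚ.+ seq y n) ∣ < ε
  +-cauchy ε 0<ε
    with cauchy x (½ ℚ.* ε) (0<½* 0<ε) | cauchy y (½ ℚ.* ε) (0<½* 0<ε)
  ... | N₁ , p₁ | N₂ , p₂ = N₁ ℕ.⊔ N₂ , λ m n N≤m N≤n → begin-strict
    ∣ (seq x m ℚ.+ seq y m) ℚ.- (seq x n ℚ.+ seq y n) ∣
      ≡⟨ cong ∣_∣ (solve 4 (λ a b c d → (a :+ b) :- (c :+ d) := (a :- c) :+ (b :- d))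
                     refl (seq x m) (seq y m) (seq x n) (seq y n)) ⟩
    ∣ (seq x m ℚ.- seq x n) ℚ.+ (seq y m ℚ.- seq y n) ∣
      ≤⟨ ℚ.∣p+q∣≤∣p∣+∣q∣ (seq x m ℚ.- seq x n) (seq y m ℚ.- seq y n) ⟩
    ∣ seq x m ℚ.- seq x n ∣ ℚ.+ ∣ seq y m ℚ.- seq y n ∣
      <⟨ ℚ.+-mono-< (p₁ m n (ℕ.m⊔n≤o⇒m≤o N₁ N₂ N≤m) (ℕ.m⊔n≤o⇒m≤o N₁ N₂ N≤n))
                    (p₂ m n (ℕ.m⊔n≤o⇒n≤o N₁ N₂ N≤m) (ℕ.m⊔n≤o⇒n≤o N₁ N₂ N≤n)) ⟩
    ½ ℚ.* ε ℚ.+ ½ ℚ.* ε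
      ≡⟨ ½+½ ε ⟩
    ε ∎
    where open ℚ.≤-Reasoning
          open +-*-Solver

-_ : ℝ → ℝ
- x = mkℝ (λ n → ℚ.- seq x n) λ ε 0<ε → let N , p = cauchy x ε 0<ε in
  N , λ m n N≤m N≤n → subst (_< ε)
    (trans (sym (ℚ.∣-p∣≡∣p∣ (seq x m ℚ.- seq x n)))
           (cong ∣_∣ (ℚ.neg-distrib-+ (seq x m) (ℚ.- seq x n))))
    (p m n N≤m N≤n)

private
  *-cauchy-from : (x y : ℕ → ℚ) (ε : ℚ) {δ B δ′ B′ : ℚ} {N₁ N₂ N₃ N₄ : ℕ} →
    0ℚ < B → 0ℚ < B′ → δ ℚ.* B ≡ ½ ℚ.* ε → δ′ ℚ.* B′ ≡ ½ ℚ.* ε →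
    (∀ m n → N₁ ℕ.≤ m → N₁ ℕ.≤ n → ∣ x m ℚ.- x n ∣ < δ) →
    (∀ n → N₂ ℕ.≤ n → ∣ y n ∣ < B) →
    (∀ m n → N₃ ℕ.≤ m → N₃ ℕ.≤ n → ∣ y m ℚ.- y n ∣ < δ′) →
    (∀ n → N₄ ℕ.≤ n → ∣ x n ∣ < B′) →
    ∀ m n → (N₁ ℕ.⊔ N₂) ℕ.⊔ (N₃ ℕ.⊔ N₄) ℕ.≤ m → (N₁ ℕ.⊔ N₂) ℕ.⊔ (N₃ ℕ.⊔ N₄) ℕ.≤ n →
    ∣ x m ℚ.* y m ℚ.- x n ℚ.* y n ∣ < ε
  *-cauchy-from x y ε {δ} {B} {δ′} {B′} {N₁} {N₂} {N₃} {N₄}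
                0<B 0<B′ δB δ′B′ x-close y-bound y-close x-bound m n N≤m N≤n =
    subst (∣ x m ℚ.* y m ℚ.- x n ℚ.* y n ∣ <_)
      (trans (cong₂ ℚ._+_ δB δ′B′) (½+½ ε))
      (*-estimate (x m) (y m) (x n) (y n) {δ} {B} {δ′} {B′} 0<B 0<B′
        (x-close m n (ℕ.m⊔n≤o⇒m≤o N₁ N₂ (left N≤m)) (ℕ.m⊔n≤o⇒m≤o N₁ N₂ (left N≤n)))
        (y-bound m (ℕ.m⊔n≤o⇒n≤o N₁ N₂ (left N≤m)))
        (y-close m n (ℕ.m⊔n≤o⇒m≤o N₃ N₄ (right N≤m)) (ℕ.m⊔n≤o⇒m≤o N₃ N₄ (right N≤n)))
        (x-bound n (ℕ.m⊔n≤o⇒n≤o N₃ N₄ (right N≤n))))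
    where
    left : ∀ {k} → (N₁ ℕ.⊔ N₂) ℕ.⊔ (N₃ ℕ.⊔ N₄) ℕ.≤ k → N₁ ℕ.⊔ N₂ ℕ.≤ k
    left = ℕ.m⊔n≤o⇒m≤o (N₁ ℕ.⊔ N₂) (N₃ ℕ.⊔ N₄)
    right : ∀ {k} → (N₁ ℕ.⊔ N₂) ℕ.⊔ (N₃ ℕ.⊔ N₄) ℕ.≤ k → N₃ ℕ.⊔ N₄ ℕ.≤ k
    right = ℕ.m⊔n≤o⇒n≤o (N₁ ℕ.⊔ N₂) (N₃ ℕ.⊔ N₄)

_*_ : ℝ → ℝ → ℝ
x * y = mkℝ (λ n → seq x n ℚ.* seq y n) λ ε 0<ε →
  let B′ , 0<B′ , N₄ , x-bound = eventuallyBounded x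
      B  , 0<B  , N₂ , y-bound = eventuallyBounded y
      δ  , 0<δ  , δB           = split B ε 0<B 0<ε
      δ′ , 0<δ′ , δ′B′         = split B′ ε 0<B′ 0<ε
      N₁ , x-close             = cauchy x δ 0<δ
      N₃ , y-close             = cauchy y δ′ 0<δ′
  in (N₁ ℕ.⊔ N₂) ℕ.⊔ (N₃ ℕ.⊔ N₄) ,
     *-cauchy-from (seq x) (seq y) ε {δ} {B} {δ′} {B′} {N₁} {N₂} {N₃} {N₄}
       0<B 0<B′ δB δ′B′ x-close y-bound y-close x-bound

Matrix : ℕ → Set
Matrix n = Fin n → Fin n → ℝ

infixr 7 _*ᵥ_

_*ᵥ_ : ∀ {n} → Matrix n → Vector ℝ n → Vector ℝ n
(M *ᵥ x) i = foldr _+_ 0ℝ (λ j → M i j * x j)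

-- The eigenvector is nonzero in the sense that not all its coordinates
-- vanish; no coordinate is required to be apart from 0.
IsEigenvalue : ∀ {n} → Matrix n → ℝ → Set
IsEigenvalue {n} M μ = ∃ λ (x : Vector ℝ n) →
  ¬ (∀ i → x i ≈ 0ℝ) × (∀ i → (M *ᵥ x) i ≈ μ * x i)

IsLargestEigenvalue : ∀ {n} → Matrix n → ℝ → Set
IsLargestEigenvalue M μ = IsEigenvalue M μ × (∀ ν → IsEigenvalue M ν → ν ≤ μ)

-- The underlying graph and the sign function on its edges are encoded
-- together: `sign u v` is `nothing` when u and v are not adjacent, and
-- `just s` when uv is an edge with sign s.
record SignedGraph (n : ℕ) : Set where
  field
    sign     : Fin n → Fin n → Maybe Sign
    sign-sym : ∀ u v → sign u v ≡ sign v u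
    loopless : ∀ v → sign v v ≡ nothing

open SignedGraph public

Adjacent : ∀ {n} → SignedGraph n → Fin n → Fin n → Set
Adjacent Γ u v = Is-just (sign Γ u v)

next : ∀ {k} .{{_ : NonZero k}} → Fin k → Fin k
next {k} i = suc (toℕ i) mod k

-- The edges of the cycle join vertex i to vertex (next i), indices modulo k.
record Cycle {n} (Γ : SignedGraph n) (k : ℕ) .{{_ : NonZero k}} : Set where
  field
    3≤k       : 3 ℕ.≤ k
    vertex    : Fin k → Fin n
    injective : Injective _≡_ _≡_ vertex
    adjacent  : ∀ i → Adjacent Γ (vertex i) (vertex (next i))

  edgeSign : Fin k → Maybe Sign
  edgeSign i = sign Γ (vertex i) (vertex (next i))

  #negativeEdges : ℕ
  #negativeEdges =
    length (filter (λ i → ≡-dec Sign._≟_ (edgeSign i) (just Sign.-)) (allFin k))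

  IsPositive : Set
  IsPositive = 2 ∣ #negativeEdges

  IsNegative : Set
  IsNegative = ¬ 2 ∣ #negativeEdges

Balanced : ∀ {n} → SignedGraph n → Set
Balanced Γ = ∀ k .{{_ : NonZero k}} (C : Cycle Γ k) → Cycle.IsPositive C

Unbalanced : ∀ {n} → SignedGraph n → Set
Unbalanced Γ = ¬ Balanced Γ

HasNegativeC₄ : ∀ {n} → SignedGraph n → Set
HasNegativeC₄ Γ = ∃ λ (C : Cycle Γ 4) → Cycle.IsNegative C

entry : Maybe Sign → ℝ
entry nothing       = 0ℝ
entry (just Sign.+) = 1ℝ
entry (just Sign.-) = - 1ℝ

adjacencyMatrix : ∀ {n} → SignedGraph n → Matrix n
adjacencyMatrix Γ i j = entry (sign Γ i j)

-- IsIndex Γ μ says that μ is λ₁(Γ); it determines μ up to _≈_.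
IsIndex : ∀ {n} → SignedGraph n → ℝ → Set
IsIndex Γ = IsLargestEigenvalue (adjacencyMatrix Γ)

-- The sign of uv after switching: u and v are on different sides of U
-- exactly when the exclusive or holds.
switchedSign : ∀ {n} → Subset n → SignedGraph n → Fin n → Fin n → Maybe Sign
switchedSign U Γ u v =
  if Vec.lookup U u xor Vec.lookup U v
  then Maybe.map opposite (sign Γ u v)
  else sign Γ u v

_SwitchesTo_ : ∀ {n} → SignedGraph n → SignedGraph n → Set
Γ SwitchesTo Δ = ∃ λ U → ∀ u v → sign Δ u v ≡ switchedSign U Γ u v

_≅_ : ∀ {n} → SignedGraph n → SignedGraph n → Set
_≅_ {n} Γ Δ = ∃ λ (π : Permutation′ n) →
  ∀ u v → sign Γ u v ≡ sign Δ (π ⟨$⟩ʳ u) (π ⟨$⟩ʳ v)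

SwitchingEquivalent : ∀ {n} → SignedGraph n → SignedGraph n → Set
SwitchingEquivalent Γ Δ = ∃ λ Γ′ → Star _SwitchesTo_ Γ Γ′ × Γ′ ≅ Δ

-- The vertices v₁, v₂, v₃, … are numbered 0, 1, 2, …, so that 2 + i stands
-- for vᵢ₊₃. The edges from v₁ and from v₂ to these vertices are the same.
Γ₁-pendant : ℕ → Maybe Sign
Γ₁-pendant zero    = just Sign.+
Γ₁-pendant (suc _) = nothing

Γ₁-sign : ℕ → ℕ → Maybe Sign
Γ₁-sign 0             0             = nothing
Γ₁-sign 0             1             = just Sign.-
Γ₁-sign 1             0             = just Sign.-
Γ₁-sign 1             1             = nothing
Γ₁-sign 0             (suc (suc j)) = Γ₁-pendant j
Γ₁-sign 1             (suc (suc j)) = Γ₁-pendant j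
Γ₁-sign (suc (suc i)) 0             = Γ₁-pendant i
Γ₁-sign (suc (suc i)) 1             = Γ₁-pendant i
Γ₁-sign (suc (suc i)) (suc (suc j)) =
  if i ℕ.≡ᵇ j then nothing else just Sign.+

private
  ≡ᵇ-sym : ∀ i j → (i ℕ.≡ᵇ j) ≡ (j ℕ.≡ᵇ i)
  ≡ᵇ-sym zero    zero    = refl
  ≡ᵇ-sym zero    (suc j) = refl
  ≡ᵇ-sym (suc i) zero    = refl
  ≡ᵇ-sym (suc i) (suc j) = ≡ᵇ-sym i j

  ≡ᵇ-refl : ∀ i → (i ℕ.≡ᵇ i) ≡ true
  ≡ᵇ-refl zero    = refl
  ≡ᵇ-refl (suc i) = ≡ᵇ-refl i

  Γ₁-sign-sym : ∀ i j → Γ₁-sign i j ≡ Γ₁-sign j i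
  Γ₁-sign-sym 0 0 = refl
  Γ₁-sign-sym 0 1 = refl
  Γ₁-sign-sym 1 0 = refl
  Γ₁-sign-sym 1 1 = refl
  Γ₁-sign-sym 0 (suc (suc _)) = refl
  Γ₁-sign-sym 1 (suc (suc _)) = refl
  Γ₁-sign-sym (suc (suc _)) 0 = refl
  Γ₁-sign-sym (suc (suc _)) 1 = refl
  Γ₁-sign-sym (suc (suc i)) (suc (suc j)) =
    cong (if_then nothing else just Sign.+) (≡ᵇ-sym i j)

  Γ₁-loopless : ∀ i → Γ₁-sign i i ≡ nothing
  Γ₁-loopless 0 = refl
  Γ₁-loopless 1 = refl
  Γ₁-loopless (suc (suc i)) = cong (if_then nothing else just Sign.+) (≡ᵇ-refl i)

Γ₁ : ∀ n → SignedGraph n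
Γ₁ n = record
  { sign     = λ u v → Γ₁-sign (toℕ u) (toℕ v)
  ; sign-sym = λ u v → Γ₁-sign-sym (toℕ u) (toℕ v)
  ; loopless = λ v → Γ₁-loopless (toℕ v)
  }

{-# OPTIONS --safe #-}
-- Switch Γ so that an eigenvector z for its index λ is nonnegative, and let z attain
-- its maximum 1 at u. Since λ > n - 3, the equation λ = Σ σ(uv) z(v) forces all
-- vertices other than u, with at most one exception w, to be positive neighbours of
-- u. Without a negative C₄ any two edges ab, bc between neighbours a, c of u have
-- the same sign, so the vertices next to a negative edge have no positive edges
-- besides those to u and w and hence small entries. Playing their equations off
-- against that of u excludes w and leaves only Γ₁.
--
-- All of this tolerates a small error η, so λ and z are replaced by rational
-- approximations. The bound λ₁(Γ₁) ≥ n - 3 + 2/(n-2)², needed to have room for η, is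
-- obtained by bisecting for a root of (λ - n + 3)((λ + 1)² - 2) = 2, the quotient
-- equation of Γ₁.
module Submission where

open import Defs hiding (_≤_; _+_; _*_; -_)
open import Data.Bool using (Bool; true; false; if_then_else_)
open import Data.Empty using (⊥; ⊥-elim)
open import Data.Fin using (Fin; zero; suc; toℕ)
import Data.Fin.Properties as Fin
open import Data.Fin.Permutation using (Permutation′; _⟨$⟩ʳ_; _⟨$⟩ˡ_; inverseˡ; transpose; _∘ₚ_)
open import Data.Fin.Subset using (Subset)
open import Data.Integer as ℤ using (+_)
import Data.Integer.Properties as ℤ
open import Data.List using (List; []; _∷_; length; lookup; filter; map; tabulate; allFin)
import Data.List as List
open import Data.List.Properties using (filter-accept; filter-reject; map-tabulate; tabulate-cong)
open import Data.List.Relation.Unary.All as All using (All; []; _∷_)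
open import Data.List.Relation.Unary.All.Properties using (¬Any⇒All¬)
open import Data.List.Relation.Unary.AllPairs using (AllPairs; []; _∷_)
import Data.List.Relation.Unary.Any as Any
import Data.List.Relation.Unary.Any.Properties as Any
open import Data.Maybe as Maybe using (Maybe; just; nothing; zipWith)
open import Data.Maybe.Properties using (≡-dec; just-injective)
open import Data.Maybe.Relation.Unary.Any using (just)
open import Data.Nat using (ℕ; zero; suc; s≤s; z≤n; NonZero)
import Data.Nat as ℕ
open import Data.Nat.Divisibility using (_∣_; divides; ∣-refl; ∣m∣n⇒∣m+n; _∣0)
open import Data.Nat.DivMod using (_mod_; m%n<n; n%n≡0; m<n⇒m%n≡m)
import Data.Nat.Properties as ℕ
open import Data.Product using (∃; ∃-syntax; _×_; _,_; proj₁; proj₂)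
open import Data.Rational as ℚ using (ℚ; 0ℚ)
import Data.Rational.Properties as ℚ
open import Data.Rational.Solver using (module +-*-Solver)
import Data.Rational.Unnormalised as ℚᵘ
import Data.Rational.Unnormalised.Properties as ℚᵘ
open import Data.Sign as Sign using (Sign)
import Data.Sign.Properties as Sign
open import Data.Sum using (_⊎_; inj₁; inj₂; [_,_]′)
open import Data.Unit using (tt)
import Data.Vec as Vec
open import Data.Vec.Functional using (foldr; updateAt)
open import Data.Vec.Functional.Properties using (updateAt-updates; updateAt-minimal)
open import Data.Vec.Properties using (lookup∘tabulate)
open import Data.Vec.Relation.Unary.All using ([]; _∷_)
open import Data.Vec.Relation.Unary.AllPairs using ([]; _∷_)
open import Data.Vec.Relation.Unary.Unique.Propositional.Properties using (lookup-injective)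
open import Function using (_∘_; const; id)
import Relation.Binary.Construct.Closure.ReflexiveTransitive as Star
open import Relation.Binary.PropositionalEquality
open import Relation.Nullary using (¬_; Dec; yes; no; does)
open import Relation.Nullary.Decidable using (_×-dec_; ¬?; decidable-stable; dec-true; dec-false)
open import Relation.Nullary.Negation using (contradiction)
open ℝ

-- Over Cauchy reals neither the sign nor the largest coordinate of an eigenvector can be decided,
-- so the argument never runs on the real eigenvector. Operations on sequences act termwise: at one
-- late index the eigenvalue equation becomes a family of rational inequalities with a small
-- residual, and signs and maxima are decidable. A coordinate bounded away from 0 is available only
-- while refuting something; this costs nothing, since a negative quadrangle can be searched for in
-- a finite graph and hence obtained by contradiction.
--
-- The residual has to be fixed before the index, so every strict inequality needs a margin known in
-- advance. Its source is 2/(n - 2)², the leading term of λ - (n - 3) in the cubic. The constants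
-- 11/5 and 1/200 are dictated by n = 5, where the estimates are tightest.
--
-- Unbalancedness enters through the easy half of its characterisation by switching: a graph that
-- can be switched to positive edges only is balanced.

-- Rational inequalities and finite sums.

module Rationals where

  open import Data.Rational
  open +-*-Solver using (solve; con; _:+_; _:*_; _:-_; :-_; _:=_)

  2ℚ 3ℚ 11/5 1/200 : ℚ
  2ℚ    = + 2 / 1
  3ℚ    = + 3 / 1
  11/5  = + 11 / 5
  1/200 = + 1 / 200

  0≤1 : 0ℚ ≤ 1ℚ
  0≤1 = ℚ.nonNegative⁻¹ 1ℚ

  0≤+ : ∀ {p q} → 0ℚ ≤ p → 0ℚ ≤ q → 0ℚ ≤ p + q
  0≤+ = ℚ.+-mono-≤

  0≤* : ∀ {p q} → 0ℚ ≤ p → 0ℚ ≤ q → 0ℚ ≤ p * q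
  0≤* {p} {q} 0≤p 0≤q = ℚ.nonNegative⁻¹ (p * q)
    {{ℚ.nonNeg*nonNeg⇒nonNeg p {{nonNegative 0≤p}} q {{nonNegative 0≤q}}}}

  0<* : ∀ {p q} → 0ℚ < p → 0ℚ < q → 0ℚ < p * q
  0<* {p} {q} 0<p 0<q = ℚ.positive⁻¹ (p * q)
    {{ℚ.pos*pos⇒pos p {{positive 0<p}} q {{positive 0<q}}}}

  gap : ∀ {p q} → p ≤ q → 0ℚ ≤ q - p
  gap {p} {q} p≤q = subst (_≤ q - p) (ℚ.+-inverseʳ p) (ℚ.+-monoˡ-≤ (- p) p≤q)

  ungap : ∀ {p q} → 0ℚ ≤ q - p → p ≤ q
  ungap {p} {q} 0≤q-p = subst₂ _≤_ (ℚ.+-identityˡ p)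
    (solve 2 (λ p q → (q :- p) :+ p := q) refl p q) (ℚ.+-monoˡ-≤ p 0≤q-p)

  ungap< : ∀ {p q} → 0ℚ < q - p → p < q
  ungap< {p} {q} 0<q-p = subst₂ _<_ (ℚ.+-identityˡ p)
    (solve 2 (λ p q → (q :- p) :+ p := q) refl p q) (ℚ.+-monoˡ-< p 0<q-p)

  infeasible : ∀ {p q} → 0ℚ ≤ p → 0ℚ < q → p + q ≡ 0ℚ → ⊥
  infeasible 0≤p 0<q p+q≡0 = ℚ.<-irrefl (sym p+q≡0) (ℚ.+-mono-≤-< 0≤p 0<q)

  -- Recursion makes `nat (suc k)` unfold to `1ℚ + nat k`, so the ring solver can treat n - 3 as an
  -- atom and n as that atom plus three ones.
  nat : ℕ → ℚ
  nat zero    = 0ℚ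
  nat (suc k) = 1ℚ + nat k

  0≤nat : ∀ k → 0ℚ ≤ nat k
  0≤nat zero    = ℚ.≤-refl
  0≤nat (suc k) = 0≤+ (ℚ.nonNegative⁻¹ 1ℚ) (0≤nat k)

  toℚᵘ-nat : ∀ k → toℚᵘ (nat k) ℚᵘ.≃ ℚᵘ.mkℚᵘ (+ k) 0
  toℚᵘ-nat zero    = ℚᵘ.≃-refl
  toℚᵘ-nat (suc k) = ℚᵘ.≃-trans (ℚ.toℚᵘ-homo-+ 1ℚ (nat k))
    (ℚᵘ.≃-trans (ℚᵘ.+-congʳ ℚᵘ.1ℚᵘ (toℚᵘ-nat k))
      (ℚᵘ.*≡* (cong (ℤ._* (+ 1)) (cong (ℤ._+_ (+ 1)) (ℤ.*-identityʳ (+ k))))))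

  -- The absolute value of the numerator suffices, the denominator being at least 1.
  archimedean : ∀ p → ∃ λ N → p ≤ nat N
  archimedean p@(mkℚ i d _) = ℤ.∣ i ∣ , ℚ.toℚᵘ-cancel-≤
    (ℚᵘ.≤-respʳ-≃ (ℚᵘ.≃-sym (toℚᵘ-nat ℤ.∣ i ∣)) (ℚᵘ.*≤* bound))
    where
    i≤∣i∣ : ∀ i → i ℤ.≤ + ℤ.∣ i ∣
    i≤∣i∣ (+ _)      = ℤ.≤-refl
    i≤∣i∣ ℤ.-[1+ _ ] = ℤ.-≤+
    bound : i ℤ.* + 1 ℤ.≤ + ℤ.∣ i ∣ ℤ.* + suc d
    bound = ℤ.≤-trans (ℤ.≤-reflexive (ℤ.*-identityʳ i)) (ℤ.≤-trans (i≤∣i∣ i)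
      (subst (+ ℤ.∣ i ∣ ℤ.≤_) (ℤ.pos-* ℤ.∣ i ∣ (suc d)) (ℤ.+≤+ (ℕ.m≤m*n ℤ.∣ i ∣ (suc d)))))

  ∑ : ∀ {n} → (Fin n → ℚ) → ℚ
  ∑ = foldr _+_ 0ℚ

  ∑-cong : ∀ {n} {f g : Fin n → ℚ} → (∀ i → f i ≡ g i) → ∑ f ≡ ∑ g
  ∑-cong {zero}  f≗g = refl
  ∑-cong {suc n} f≗g = cong₂ _+_ (f≗g zero) (∑-cong (f≗g ∘ suc))

  ∑-*ˡ : ∀ {n} c (f : Fin n → ℚ) → ∑ (λ i → c * f i) ≡ c * ∑ f
  ∑-*ˡ {zero}  c f = sym (ℚ.*-zeroʳ c)
  ∑-*ˡ {suc n} c f = trans (cong (_+_ (c * f zero)) (∑-*ˡ c (f ∘ suc)))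
    (sym (ℚ.*-distribˡ-+ c (f zero) (∑ (f ∘ suc))))

  ∑-bounded : ∀ {n} c (f : Fin n → ℚ) → (∀ i → f i ≤ c) → ∑ f ≤ nat n * c
  ∑-bounded {zero}  c f f≤c = ℚ.≤-reflexive (sym (ℚ.*-zeroˡ c))
  ∑-bounded {suc n} c f f≤c = ℚ.≤-trans
    (ℚ.+-mono-≤ (f≤c zero) (∑-bounded c (f ∘ suc) (f≤c ∘ suc)))
    (ℚ.≤-reflexive (solve 2 (λ c k → c :+ k :* c := (con 1ℚ :+ k) :* c) refl c (nat n)))

  ∑-updateAt : ∀ {n} (f : Fin n → ℚ) c j → ∑ f ≡ (f j - c) + ∑ (updateAt f j (const c))
  ∑-updateAt {suc n} f c zero =
    solve 3 (λ x c s → x :+ s := (x :- c) :+ (c :+ s)) refl (f zero) c (∑ (f ∘ suc))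
  ∑-updateAt {suc n} f c (suc j) = trans (cong (_+_ (f zero)) (∑-updateAt (f ∘ suc) c j))
    (solve 3 (λ x y s → x :+ (y :+ s) := y :+ (x :+ s)) refl
      (f zero) (f (suc j) - c) (∑ (updateAt (f ∘ suc) j (const c))))

  -- Correction to the uniform estimate n·c when the listed indices trade the bound c for bounds of
  -- their own.
  excess : ∀ {n} → ℚ → List (Fin n × ℚ) → ℚ
  excess c []             = 0ℚ
  excess c ((_ , b) ∷ ps) = (b - c) + excess c ps

  -- Overwriting f by c at the first listed index lets the tail speak of a function that meets the
  -- default bound there; distinctness keeps the other listed bounds intact. Every row estimate
  -- below is an instance.
  ∑-≤-excess : ∀ {n} c (ps : List (Fin n × ℚ)) (f : Fin n → ℚ) →
    AllPairs (λ p q → proj₁ p ≢ proj₁ q) ps →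
    All (λ p → f (proj₁ p) ≤ proj₂ p) ps →
    (∀ j → All (λ p → j ≢ proj₁ p) ps → f j ≤ c) →
    ∑ f ≤ excess c ps + nat n * c
  ∑-≤-excess {n} c [] f _ _ f≤c = ℚ.≤-trans (∑-bounded c f (λ j → f≤c j []))
    (ℚ.≤-reflexive (sym (ℚ.+-identityˡ (nat n * c))))
  ∑-≤-excess {n} c ((j , b) ∷ ps) f (j≢ ∷ distinct) (fj≤b ∷ bounds) f≤c = begin
    ∑ f                                        ≡⟨ ∑-updateAt f c j ⟩
    (f j - c) + ∑ g                            ≤⟨ ℚ.+-mono-≤ (ℚ.+-monoˡ-≤ (- c) fj≤b)
                                                   (∑-≤-excess c ps g distinct g-bounds g≤c) ⟩
    (b - c) + (excess c ps + nat n * c)        ≡⟨ ℚ.+-assoc (b - c) (excess c ps) (nat n * c) ⟨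
    (b - c) + excess c ps + nat n * c          ∎
    where
    open ℚ.≤-Reasoning
    g = updateAt f j (const c)
    g≡f : ∀ {k} → j ≢ k → g k ≡ f k
    g≡f {k} j≢k = updateAt-minimal k j f (j≢k ∘ sym)
    g-bounds : All (λ p → g (proj₁ p) ≤ proj₂ p) ps
    g-bounds = All.zipWith (λ { {p} (j≢p , fp≤) → subst (_≤ proj₂ p) (sym (g≡f j≢p)) fp≤ }) (j≢ , bounds)
    g≤c : ∀ k → All (λ p → k ≢ proj₁ p) ps → g k ≤ c
    g≤c k k≢ with k Fin.≟ j
    ... | yes refl = ℚ.≤-reflexive (updateAt-updates j f)
    ... | no k≢j   = subst (_≤ c) (sym (g≡f (k≢j ∘ sym))) (f≤c k (k≢j ∷ k≢))

  ∑-const : ∀ n c → ∑ {n} (λ _ → c) ≡ nat n * c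
  ∑-const zero    c = sym (ℚ.*-zeroˡ c)
  ∑-const (suc n) c = trans (cong (_+_ c) (∑-const n c))
    (solve 2 (λ c k → c :+ k :* c := (con 1ℚ :+ k) :* c) refl c (nat n))

  p≤∣p∣ : ∀ p → p ≤ ∣ p ∣
  p≤∣p∣ p with ℚ.∣p∣≡p∨∣p∣≡-p p
  ... | inj₁ ∣p∣≡p  = ℚ.≤-reflexive (sym ∣p∣≡p)
  ... | inj₂ ∣p∣≡-p = ungap (subst (0ℚ ≤_)
    (cong (_+_ ∣ p ∣) ∣p∣≡-p) (0≤+ (ℚ.0≤∣p∣ p) (ℚ.0≤∣p∣ p)))

  ∣p-q∣≤ : ∀ {a b p q} → a ≤ p → p ≤ b → a ≤ q → q ≤ b → ∣ p - q ∣ ≤ b - a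
  ∣p-q∣≤ {a} {b} {p} {q} a≤p p≤b a≤q q≤b with ℚ.∣p∣≡p∨∣p∣≡-p (p - q)
  ... | inj₁ eq = subst (_≤ b - a) (sym eq) (ℚ.+-mono-≤ p≤b (ℚ.neg-antimono-≤ a≤q))
  ... | inj₂ eq = subst (_≤ b - a)
    (trans (solve 2 (λ p q → q :- p := :- (p :- q)) refl p q) (sym eq)) (ℚ.+-mono-≤ q≤b (ℚ.neg-antimono-≤ a≤p))

  inverse : ∀ {p} → 0ℚ < p → ∃[ q ] 0ℚ < q × p * q ≡ 1ℚ
  inverse {p} 0<p = 1/ p , ℚ.positive⁻¹ (1/ p) {{ℚ.1/pos⇒pos p}} , ℚ.*-inverseʳ p
    where
    instance
      p⁺  = positive 0<p
      p≢0 = ℚ.pos⇒nonZero p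

open Rationals

-- Numerical contradictions between rows of an approximate eigenvector.

-- Each contradiction is a certificate: products of nonnegative quantities plus a
-- positive term whose sum vanishes identically.
module Estimates (l ν η : ℚ) (0<η : 0ℚ ℚ.< η) (η≤1/200 : η ℚ.≤ 1/200)
                 (ν+2η≤l : ν ℚ.+ (η ℚ.+ η) ℚ.≤ l) (11/5≤l : 11/5 ℚ.≤ l) where

  open import Data.Rational hiding (ℚ; 0ℚ)
  open +-*-Solver using (solve; con; _:+_; _:*_; _:-_; :-_; _:=_)

  0≤η : 0ℚ ≤ η
  0≤η = ℚ.<⇒≤ 0<η

  0<l-2 : 0ℚ < l - 2ℚ
  0<l-2 = subst (0ℚ <_) (solve 1 (λ l → (l :- con 11/5) :+ con (+ 1 / 5) := l :- con 2ℚ) refl l)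
    (ℚ.+-mono-≤-< (gap 11/5≤l) (ℚ.positive⁻¹ (+ 1 / 5)))

  0≤l-2 : 0ℚ ≤ l - 2ℚ
  0≤l-2 = ℚ.<⇒≤ 0<l-2

  0<l : 0ℚ < l
  0<l = ℚ.<-≤-trans (ℚ.positive⁻¹ 11/5) 11/5≤l

  0≤l : 0ℚ ≤ l
  0≤l = ℚ.<⇒≤ 0<l

  -- Here ν is n - 3, what remains of the row of u when u and two further vertices contribute
  -- nothing positive.
  two-missing : l ≤ ν + η → ⊥
  two-missing U = infeasible (0≤+ (gap U) (gap ν+2η≤l)) 0<η
    (solve 3 (λ l ν η → ((ν :+ η :- l) :+ (l :- (ν :+ (η :+ η)))) :+ η := con 0ℚ) refl l ν η)

  -- The entries a, b belong to the ends of a negative edge, c and d to two vertices without a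
  -- positive edge between them. The row of u times l, with the other four rows inserted, gives (l +
  -- 2)(l - ν) + (a + b) ≤ (l + 4)η, whereas l - ν ≥ 2η.
  negative-edge : ∀ {a b c d} → 0ℚ ≤ a → 0ℚ ≤ b →
    l * a ≤ 1ℚ - b + η → l * b ≤ 1ℚ - a + η →
    l * c ≤ ν - 1ℚ + η → l * d ≤ ν - 1ℚ + η →
    l ≤ ν - 2ℚ + (a + b + c + d) + η → ⊥
  negative-edge {a} {b} {c} {d} 0≤a 0≤b A B C D U = infeasible
    (0≤+ (0≤+ (0≤+ (0≤+ (gap A) (gap B)) (0≤+ (gap C) (gap D))) (0≤* 0≤l (gap U)))
         (0≤+ (0≤* (0≤+ 0≤l 0≤2) (gap ν+2η≤l)) (0≤+ 0≤a 0≤b)))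
    (0<* 0<l 0<η)
    (solve 7 (λ l ν η a b c d →
      ((((con 1ℚ :- b :+ η :- l :* a) :+ (con 1ℚ :- a :+ η :- l :* b)) :+
        ((ν :- con 1ℚ :+ η :- l :* c) :+ (ν :- con 1ℚ :+ η :- l :* d))) :+
        l :* (ν :- con 2ℚ :+ (a :+ b :+ c :+ d) :+ η :- l) :+
        ((l :+ con 2ℚ) :* (l :- (ν :+ (η :+ η))) :+ (a :+ b))) :+ l :* η := con 0ℚ)
      refl l ν η a b c d)
    where
    0≤2 : 0ℚ ≤ 2ℚ
    0≤2 = ℚ.nonNegative⁻¹ 2ℚ

  -- The situation is a triangle u, w, a with uw negative and a the only positive neighbour of w.
  -- Row a plus twice row w leaves (l - 2)a + (2l - 1)w ≤ 3η - 1 < 0, impossible for l > 2.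
  pendant : ∀ {a w} → 0ℚ ≤ a → 0ℚ ≤ w →
    l * w ≤ a - 1ℚ + η → l * a ≤ 1ℚ + w + η → ⊥
  pendant {a} {w} 0≤a 0≤w W A = infeasible
    (0≤+ (0≤+ (0≤+ (gap A) (0≤* 0≤l-2 0≤a)) (0≤+ (gap W) (gap W)))
         (0≤+ (0≤+ (0≤+ (0≤* 0≤l-2 0≤w) (0≤* 0≤l-2 0≤w)) (0≤* 0≤3 0≤w)) (0≤* 0≤3 (gap η≤1/200))))
    (ℚ.positive⁻¹ (+ 197 / 200))
    (solve 4 (λ l η a w →
      (((con 1ℚ :+ w :+ η :- l :* a) :+ (l :- con 2ℚ) :* a) :+
        ((a :- con 1ℚ :+ η :- l :* w) :+ (a :- con 1ℚ :+ η :- l :* w)) :+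
        (((l :- con 2ℚ) :* w :+ (l :- con 2ℚ) :* w) :+ con 3ℚ :* w :+ con 3ℚ :* (con 1/200 :- η)))
        :+ con (+ 197 / 200) := con 0ℚ)
      refl l η a w)
    where
    0≤3 : 0ℚ ≤ 3ℚ
    0≤3 = ℚ.nonNegative⁻¹ 3ℚ

  private
    -- s is the sum of the two entries of z that the row of u does not bound by 1.
    large : ∀ {s w} → l ≤ ν - 1ℚ + s - w + η → 0ℚ ≤ s - (1ℚ + w + η)
    large {s} {w} U = subst (0ℚ ≤_)
      (solve 5 (λ l ν η s w →
        (ν :- con 1ℚ :+ s :- w :+ η :- l) :+ (l :- (ν :+ (η :+ η))) := s :- (con 1ℚ :+ w :+ η))
        refl l ν η s w)
      (0≤+ (gap U) (gap ν+2η≤l))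

    0<1+w+η : ∀ {w} → 0ℚ ≤ w → 0ℚ < 1ℚ + w + η
    0<1+w+η 0≤w = ℚ.+-mono-≤-< (0≤+ 0≤1 0≤w) 0<η

  -- The first two rows give l(a + b) ≤ 2(1 + w + η), the row of u gives a + b ≥ 1 + w + η, and l >
  -- 2.
  two-isolated : ∀ {a b w} → 0ℚ ≤ w →
    l * a ≤ 1ℚ + w + η → l * b ≤ 1ℚ + w + η → l ≤ ν - 1ℚ + (a + b) - w + η → ⊥
  two-isolated {a} {b} {w} 0≤w A B U = infeasible
    (0≤+ (0≤+ (gap A) (gap B)) (0≤* 0≤l (large U)))
    (0<* 0<l-2 (0<1+w+η 0≤w))
    (solve 5 (λ l η a b w →
      (((con 1ℚ :+ w :+ η :- l :* a) :+ (con 1ℚ :+ w :+ η :- l :* b)) :+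
        l :* (a :+ b :- (con 1ℚ :+ w :+ η))) :+ (l :- con 2ℚ) :* (con 1ℚ :+ w :+ η) := con 0ℚ)
      refl l η a b w)

  -- As in `two-isolated`, with the factor l improved to l + 1 by the negative edge between the
  -- vertices of a and b.
  negative-edge-negative-w : ∀ {a b w} → 0ℚ ≤ w →
    l * a ≤ 1ℚ - b + w + η → l * b ≤ 1ℚ - a + w + η → l ≤ ν - 1ℚ + (a + b) - w + η → ⊥
  negative-edge-negative-w {a} {b} {w} 0≤w A B U = infeasible
    (0≤+ (0≤+ (gap A) (gap B)) (0≤* (0≤+ 0≤l 0≤1) (large U)))
    (0<* (ℚ.+-mono-<-≤ 0<l-2 0≤1) (0<1+w+η 0≤w))
    (solve 5 (λ l η a b w →
      (((con 1ℚ :- b :+ w :+ η :- l :* a) :+ (con 1ℚ :- a :+ w :+ η :- l :* b)) :+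
        (l :+ con 1ℚ) :* (a :+ b :- (con 1ℚ :+ w :+ η))) :+
        (l :- con 2ℚ :+ con 1ℚ) :* (con 1ℚ :+ w :+ η) := con 0ℚ)
      refl l η a b w)

  -- Without an edge uw only a + b ≥ 1 + η remains, against (l + 1)(a + b) ≤ 4 + 2η. These collide
  -- because l + 1 ≥ ν + 1 ≥ 4.
  negative-edge-missing-w : ∀ {a b w} → 3ℚ ≤ ν → w ≤ 1ℚ →
    l * a ≤ 1ℚ - b + w + η → l * b ≤ 1ℚ - a + w + η → l ≤ ν - 1ℚ + (a + b) + η → ⊥
  negative-edge-missing-w {a} {b} {w} 3≤ν w≤1 A B U = infeasible
    (0≤+ (0≤+ (0≤+ (gap A) (gap B)) (0≤+ (gap w≤1) (gap w≤1)))
         (0≤+ (0≤* (0≤+ 0≤l 0≤1) (0≤+ (gap U) (gap ν+2η≤l)))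
              (0≤+ (0≤* (0≤+ 0≤1 0≤η) (0≤+ (gap ν+2η≤l) (gap 3≤ν))) (0≤* 0≤η 0≤η))))
    (ℚ.+-mono-<-≤ (0<* (ℚ.positive⁻¹ (+ 4 / 1)) 0<η) (0≤* 0≤η 0≤η))
    (solve 6 (λ l ν η a b w →
      (((con 1ℚ :- b :+ w :+ η :- l :* a) :+ (con 1ℚ :- a :+ w :+ η :- l :* b)) :+
        ((con 1ℚ :- w) :+ (con 1ℚ :- w)) :+
        ((l :+ con 1ℚ) :* ((ν :- con 1ℚ :+ (a :+ b) :+ η :- l) :+ (l :- (ν :+ (η :+ η)))) :+
         ((con 1ℚ :+ η) :* ((l :- (ν :+ (η :+ η))) :+ (ν :- con 3ℚ)) :+ η :* η))) :+
        (con (+ 4 / 1) :* η :+ η :* η) := con 0ℚ)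
      refl l ν η a b w)

  -- For n = 5 the entry c of a third vertex has to be estimated too. From (l + 1)(a + b) ≤ 4 + 2η
  -- and (l + 1)c ≤ 3 + η follows l(l + 1) ≤ 7 + (l + 4)η; at l = 11/5 and η = 1/200 the two sides
  -- are 7.04 and 7.031.
  negative-edge-five : ∀ {a b c w} → ν ≡ 2ℚ → w ≤ 1ℚ → c ≤ 1ℚ →
    l * a ≤ 1ℚ - b + w + η → l * b ≤ 1ℚ - a + w + η → l * c ≤ ν + η →
    l ≤ ν - 2ℚ + (a + b + c) + η → ⊥
  negative-edge-five {a} {b} {c} {w} refl w≤1 c≤1 A B C U = infeasible
    (0≤+ (0≤+ (0≤+ (0≤+ (gap A) (gap B)) (0≤+ (gap w≤1) (gap w≤1)))
              (0≤+ (0≤* (0≤+ 0≤l 0≤1) (gap U)) (0≤+ (gap C) (gap c≤1))))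
         (0≤+ (0≤+ (0≤* k k) (0≤* 5′ k)) (0≤+ (0≤* k (gap η≤1/200)) (0≤* 6′ (gap η≤1/200)))))
    (ℚ.positive⁻¹ (+ 9 / 1000))
    (solve 6 (λ l η a b c w → let κ = l :- con 11/5 in
      ((((con 1ℚ :- b :+ w :+ η :- l :* a) :+ (con 1ℚ :- a :+ w :+ η :- l :* b)) :+
        ((con 1ℚ :- w) :+ (con 1ℚ :- w)) :+
        ((l :+ con 1ℚ) :* (con 2ℚ :- con 2ℚ :+ (a :+ b :+ c) :+ η :- l) :+
          ((con 2ℚ :+ η :- l :* c) :+ (con 1ℚ :- c)))) :+
        ((κ :* κ :+ con (+ 1079 / 200) :* κ) :+
          (κ :* (con 1/200 :- η) :+ con (+ 31 / 5) :* (con 1/200 :- η)))) :+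
        con (+ 9 / 1000) := con 0ℚ)
      refl l η a b c w)
    where
    k : 0ℚ ≤ l - 11/5
    k = gap 11/5≤l
    5′ : 0ℚ ≤ + 1079 / 200
    5′ = ℚ.nonNegative⁻¹ (+ 1079 / 200)
    6′ : 0ℚ ≤ + 31 / 5
    6′ = ℚ.nonNegative⁻¹ (+ 31 / 5)

-- Structure of a graph with an approximate eigenvector and no negative quadrangle.

module ExtremalStructure where

  open import Data.Rational
  open +-*-Solver using (solve; con; _:+_; _:*_; _:-_; :-_; _:=_)

  weight : Maybe Sign → ℚ
  weight nothing       = 0ℚ
  weight (just Sign.+) = 1ℚ
  weight (just Sign.-) = - 1ℚ

  weight*-≤ : ∀ s {x} → 0ℚ ≤ x → weight s * x ≤ x
  weight*-≤ nothing       {x} 0≤x = subst (_≤ x) (sym (ℚ.*-zeroˡ x)) 0≤x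
  weight*-≤ (just Sign.+) {x} 0≤x = ℚ.≤-reflexive (ℚ.*-identityˡ x)
  weight*-≤ (just Sign.-) {x} 0≤x = ungap (subst (0ℚ ≤_)
    (solve 1 (λ x → x :+ x := x :- con (- 1ℚ) :* x) refl x) (0≤+ 0≤x 0≤x))

  weight*-≤0 : ∀ s {x} → 0ℚ ≤ x → s ≢ just Sign.+ → weight s * x ≤ 0ℚ
  weight*-≤0 nothing       {x} 0≤x _  = ℚ.≤-reflexive (ℚ.*-zeroˡ x)
  weight*-≤0 (just Sign.+)     _   ≢+ = contradiction refl ≢+
  weight*-≤0 (just Sign.-) {x} 0≤x _  = ungap (subst (0ℚ ≤_)
    (solve 1 (λ x → x := con 0ℚ :- con (- 1ℚ) :* x) refl x) 0≤x)

  -- The graph can be switched to have positive edges only.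
  Potential : ∀ {n} → SignedGraph n → Set
  Potential {n} Γ = ∃ λ (q : Fin n → Sign) → ∀ u v s → sign Γ u v ≡ just s → s ≡ q u Sign.* q v

  -- Only opposite vertices have to be assumed distinct; consecutive ones differ because the graph
  -- is loopless.
  NoNegativeQuadrangle : ∀ {n} → SignedGraph n → Set
  NoNegativeQuadrangle {n} Γ = ∀ {a b c d s t p q} → a ≢ c → b ≢ d →
    sign Γ a b ≡ just s → sign Γ b c ≡ just t → sign Γ c d ≡ just p → sign Γ d a ≡ just q →
    s Sign.* (t Sign.* (p Sign.* q)) ≢ Sign.-

  avoid : ∀ {n} (xs : List (Fin n)) → length xs ℕ.< n → ∃[ d ] All (d ≢_) xs
  avoid {n} xs ∣xs∣<n with Fin.any? (λ d → ¬? (Any.any? (d Fin.≟_) xs))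
  ... | yes (d , d∉xs) = d , ¬Any⇒All¬ xs d∉xs
  ... | no covered =
    let member i = decidable-stable (Any.any? (i Fin.≟_) xs) (λ i∉xs → covered (i , i∉xs))
        i , j , i<j , same = Fin.pigeonhole ∣xs∣<n (Any.index ∘ member)
    in contradiction
         (trans (Any.lookup-index (member i))
           (trans (cong (lookup xs) same) (sym (Any.lookup-index (member j)))))
         (Fin.<⇒≢ i<j)

  -- One-sided rows suffice: they bound entries of z from above and, at u, bound l itself.
  record ApproximateEigenvector {n} (Γ : SignedGraph n) (l η : ℚ) : Set where
    field
      z    : Fin n → ℚ
      0≤z  : ∀ v → 0ℚ ≤ z v
      z≤1  : ∀ v → z v ≤ 1ℚ
      u    : Fin n
      zu≡1 : z u ≡ 1ℚ
      row  : ∀ v → l * z v ≤ ∑ (λ j → weight (sign Γ v j) * z j) + η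

  -- a, b and u play the roles of v₁, v₂ and v₃ in Γ₁.
  IsExtremal : ∀ {n} → SignedGraph n → (u a b : Fin n) → Set
  IsExtremal Γ u a b =
    a ≢ u × b ≢ u × a ≢ b × sign Γ u a ≡ just Sign.+ × sign Γ u b ≡ just Sign.+ × sign Γ a b ≡ just Sign.- ×
    (∀ c → c ≢ u → c ≢ a → c ≢ b → sign Γ u c ≡ just Sign.+ × sign Γ a c ≡ nothing × sign Γ b c ≡ nothing) ×
    (∀ c d → c ≢ d → c ≢ u → c ≢ a → c ≢ b → d ≢ u → d ≢ a → d ≢ b → sign Γ c d ≡ just Sign.+)

  nat≥3⊎nat≡2 : ∀ r → 3ℚ ≤ nat (2 ℕ.+ r) ⊎ nat (2 ℕ.+ r) ≡ 2ℚ
  nat≥3⊎nat≡2 zero    = inj₂ refl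
  nat≥3⊎nat≡2 (suc r) = inj₁ (ungap (subst (0ℚ ≤_)
    (solve 1 (λ x → x := con 1ℚ :+ (con 1ℚ :+ (con 1ℚ :+ x)) :- con 3ℚ) refl (nat r)) (0≤nat r)))

  module Structure (r : ℕ) (Γ : SignedGraph (5 ℕ.+ r)) (noC₄ : NoNegativeQuadrangle Γ)
                   (noPotential : ¬ Potential Γ) (l η : ℚ) (E : ApproximateEigenvector Γ l η)
                   (0<η : 0ℚ < η) (η≤1/200 : η ≤ 1/200)
                   (ν+2η≤l : nat (2 ℕ.+ r) + (η + η) ≤ l) (11/5≤l : 11/5 ≤ l) where

    open ApproximateEigenvector E

    private
      n = 5 ℕ.+ r
      ν = nat (2 ℕ.+ r)

    open Estimates l ν η 0<η η≤1/200 ν+2η≤l 11/5≤l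

    Pos Neg : Fin n → Fin n → Set
    Pos v w = sign Γ v w ≡ just Sign.+
    Neg v w = sign Γ v w ≡ just Sign.-

    pos? : ∀ v w → Dec (Pos v w)
    pos? v w = ≡-dec Sign._≟_ (sign Γ v w) (just Sign.+)

    neg? : ∀ v w → Dec (Neg v w)
    neg? v w = ≡-dec Sign._≟_ (sign Γ v w) (just Sign.-)

    flip : ∀ {v w s} → sign Γ v w ≡ s → sign Γ w v ≡ s
    flip {v} {w} = trans (sign-sym Γ w v)

    neg⇒¬pos : ∀ {v w} → Neg v w → ¬ Pos v w
    neg⇒¬pos v-w v+w with () ← trans (sym v-w) v+w

    ¬pos-refl : ∀ v → ¬ Pos v v
    ¬pos-refl v v+v with () ← trans (sym (loopless Γ v)) v+v

    ¬neg-refl : ∀ v → ¬ Neg v v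
    ¬neg-refl v v-v with () ← trans (sym (loopless Γ v)) v-v

    term : Fin n → Fin n → ℚ
    term v j = weight (sign Γ v j) * z j

    term≤z : ∀ v j → term v j ≤ z j
    term≤z v j = weight*-≤ (sign Γ v j) (0≤z j)

    term≤1 : ∀ v j → term v j ≤ 1ℚ
    term≤1 v j = ℚ.≤-trans (term≤z v j) (z≤1 j)

    term≤0 : ∀ v j → ¬ Pos v j → term v j ≤ 0ℚ
    term≤0 v j = weight*-≤0 (sign Γ v j) (0≤z j)

    term-refl≤0 : ∀ v → term v v ≤ 0ℚ
    term-refl≤0 v = term≤0 v v (¬pos-refl v)

    term≤-z : ∀ {v j} → Neg v j → term v j ≤ - z j
    term≤-z {v} {j} v-j = ℚ.≤-reflexive (trans (cong (λ s → weight s * z j) v-j)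
      (solve 1 (λ x → con (- 1ℚ) :* x := :- x) refl (z j)))

    row-≤ : ∀ v c (ps : List (Fin n × ℚ)) → AllPairs (λ p q → proj₁ p ≢ proj₁ q) ps →
      All (λ p → term v (proj₁ p) ≤ proj₂ p) ps →
      (∀ j → All (λ p → j ≢ proj₁ p) ps → term v j ≤ c) →
      l * z v ≤ excess c ps + nat n * c + η
    row-≤ v c ps distinct bounds ≤c =
      ℚ.≤-trans (row v) (ℚ.+-monoˡ-≤ η (∑-≤-excess c ps (term v) distinct bounds ≤c))

    l*zu≡l : l * z u ≡ l
    l*zu≡l = trans (cong (l *_) zu≡1) (ℚ.*-identityʳ l)

    two-nonneighbours : ∀ {j k} → j ≢ u → k ≢ u → j ≢ k → ¬ Pos u j → ¬ Pos u k → ⊥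
    two-nonneighbours {j} {k} j≢u k≢u j≢k ¬uj ¬uk = two-missing
      (subst₂ _≤_ l*zu≡l
        (solve 2 (λ r η →
          ((con 0ℚ :- con 1ℚ) :+ ((con 0ℚ :- con 1ℚ) :+ ((con 0ℚ :- con 1ℚ) :+ con 0ℚ))) :+
          (con 1ℚ :+ (con 1ℚ :+ (con 1ℚ :+ r))) :* con 1ℚ :+ η := r :+ η) refl ν η)
        (row-≤ u 1ℚ ((u , 0ℚ) ∷ (j , 0ℚ) ∷ (k , 0ℚ) ∷ [])
          ((j≢u ∘ sym ∷ k≢u ∘ sym ∷ []) ∷ (j≢k ∷ []) ∷ [] ∷ [])
          (term-refl≤0 u ∷ term≤0 u j ¬uj ∷ term≤0 u k ¬uk ∷ [])
          (λ i _ → term≤1 u i)))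

    -- Otherwise u, a, b, c is a quadrangle whose only negative edge is ab or bc.
    same-sign : ∀ {a b c s t} → Pos u a → Pos u c → a ≢ c → b ≢ u →
      sign Γ a b ≡ just s → sign Γ b c ≡ just t → s ≡ t
    same-sign {s = Sign.+} {Sign.+} _ _ _ _ _ _ = refl
    same-sign {s = Sign.-} {Sign.-} _ _ _ _ _ _ = refl
    same-sign {s = Sign.+} {Sign.-} u+a u+c a≢c b≢u ab bc =
      contradiction refl (noC₄ (b≢u ∘ sym) a≢c u+a ab bc (flip u+c))
    same-sign {s = Sign.-} {Sign.+} u+a u+c a≢c b≢u ab bc =
      contradiction refl (noC₄ (b≢u ∘ sym) a≢c u+a ab bc (flip u+c))

    ≢u : ∀ {v} → Pos u v → v ≢ u
    ≢u u+v refl = ¬pos-refl u u+v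

    neg-≢ : ∀ {a b} → Neg a b → a ≢ b
    neg-≢ a-b refl = ¬neg-refl _ a-b

    -- The path b, a, v joins two positive neighbours of u, so `same-sign` passes the sign of ab on
    -- to av.
    near-negative : ∀ {a b v} → Pos u a → Pos u b → Neg a b → Pos u v → v ≢ b → ¬ Pos a v
    near-negative u+a u+b a-b u+v v≢b a+v
      with () ← same-sign u+b u+v (v≢b ∘ sym) (≢u u+a) (flip a-b) a+v

    -- The case that all other vertices are positive neighbours of u.

    module NoException (P : ∀ v → v ≢ u → Pos u v) where

      module _ {a b} (a≢u : a ≢ u) (b≢u : b ≢ u) (a-b : Neg a b) where

        private
          a≢b = neg-≢ a-b
          u+a = P a a≢u
          u+b = P b b≢u

          far : ∀ {v} → v ≢ u → v ≢ b → ¬ Pos a v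
          far v≢u v≢b = near-negative u+a u+b a-b (P _ v≢u) v≢b

          far′ : ∀ {v} → v ≢ u → v ≢ a → ¬ Pos b v
          far′ v≢u v≢a = near-negative u+b u+a (flip a-b) (P _ v≢u) v≢a

        row-negative : l * z a ≤ 1ℚ - z b + η
        row-negative = subst (l * z a ≤_)
          (solve 3 (λ b n η → ((con 1ℚ :- con 0ℚ) :+ ((:- b :- con 0ℚ) :+ con 0ℚ)) :+ n :* con 0ℚ :+ η
                              := con 1ℚ :- b :+ η) refl (z b) (nat n) η)
          (row-≤ a 0ℚ ((u , 1ℚ) ∷ (b , - z b) ∷ [])
            ((b≢u ∘ sym ∷ []) ∷ [] ∷ [])
            (term≤1 a u ∷ term≤-z a-b ∷ [])
            (λ { j (j≢u ∷ j≢b ∷ []) → term≤0 a j (far j≢u j≢b) }))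

        -- No positive edge leads from c to c, d, a or b, so at most n - 4 = ν - 1 terms remain.
        row-other : ∀ {c d} → c ≢ u → c ≢ a → c ≢ b → d ≢ a → d ≢ b → c ≢ d → ¬ Pos c d →
          l * z c ≤ ν - 1ℚ + η
        row-other {c} {d} c≢u c≢a c≢b d≢a d≢b c≢d ¬cd = subst (l * z c ≤_)
          (solve 2 (λ r η →
            ((con 0ℚ :- con 1ℚ) :+ ((con 0ℚ :- con 1ℚ) :+
              ((con 0ℚ :- con 1ℚ) :+ ((con 0ℚ :- con 1ℚ) :+ con 0ℚ)))) :+
            (con 1ℚ :+ (con 1ℚ :+ (con 1ℚ :+ r))) :* con 1ℚ :+ η := r :- con 1ℚ :+ η) refl ν η)
          (row-≤ c 1ℚ ((c , 0ℚ) ∷ (a , 0ℚ) ∷ (b , 0ℚ) ∷ (d , 0ℚ) ∷ [])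
            ((c≢a ∷ c≢b ∷ c≢d ∷ []) ∷ (a≢b ∷ d≢a ∘ sym ∷ []) ∷ (d≢b ∘ sym ∷ []) ∷ [] ∷ [])
            (term-refl≤0 c ∷ term≤0 c a (far c≢u c≢b ∘ flip) ∷ term≤0 c b (far′ c≢u c≢a ∘ flip)
              ∷ term≤0 c d ¬cd ∷ [])
            (λ j _ → term≤1 c j))

      complete : ∀ {a b} → a ≢ u → b ≢ u → Neg a b → ∀ c d → c ≢ d →
        c ≢ u → c ≢ a → c ≢ b → d ≢ u → d ≢ a → d ≢ b → Pos c d
      complete {a} {b} a≢u b≢u a-b c d c≢d c≢u c≢a c≢b d≢u d≢a d≢b =
        decidable-stable (pos? c d) λ ¬cd →
          negative-edge (0≤z a) (0≤z b)
            (row-negative a≢u b≢u a-b) (row-negative b≢u a≢u (flip a-b))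
            (row-other a≢u b≢u a-b c≢u c≢a c≢b d≢a d≢b c≢d ¬cd)
            (row-other a≢u b≢u a-b d≢u d≢a d≢b c≢a c≢b (c≢d ∘ sym) (¬cd ∘ flip))
            (subst₂ _≤_ l*zu≡l
              (solve 6 (λ r η a b c d →
                ((con 0ℚ :- con 1ℚ) :+ ((a :- con 1ℚ) :+ ((b :- con 1ℚ) :+
                  ((c :- con 1ℚ) :+ ((d :- con 1ℚ) :+ con 0ℚ))))) :+
                (con 1ℚ :+ (con 1ℚ :+ (con 1ℚ :+ r))) :* con 1ℚ :+ η
                := r :- con 2ℚ :+ (a :+ b :+ c :+ d) :+ η) refl ν η (z a) (z b) (z c) (z d))
              (row-≤ u 1ℚ ((u , 0ℚ) ∷ (a , z a) ∷ (b , z b) ∷ (c , z c) ∷ (d , z d) ∷ [])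
                ((a≢u ∘ sym ∷ b≢u ∘ sym ∷ c≢u ∘ sym ∷ d≢u ∘ sym ∷ []) ∷
                 (neg-≢ a-b ∷ c≢a ∘ sym ∷ d≢a ∘ sym ∷ []) ∷ (c≢b ∘ sym ∷ d≢b ∘ sym ∷ []) ∷
                 (c≢d ∷ []) ∷ [] ∷ [])
                (term-refl≤0 u ∷ term≤z u a ∷ term≤z u b ∷ term≤z u c ∷ term≤z u d ∷ [])
                (λ j _ → term≤1 u j)))

      isolated : ∀ {a b} → a ≢ u → b ≢ u → Neg a b → ∀ c → c ≢ u → c ≢ a → c ≢ b → sign Γ a c ≡ nothing
      isolated {a} {b} a≢u b≢u a-b c c≢u c≢a c≢b with sign Γ a c in ac
      ... | nothing     = refl
      ... | just Sign.+ =
        contradiction ac (near-negative (P a a≢u) (P b b≢u) a-b (P c c≢u) c≢b)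
      -- A fifth vertex d: `complete` makes cd positive, which is forbidden next to the negative
      -- edge ac.
      ... | just Sign.- with avoid (u ∷ a ∷ b ∷ c ∷ []) (s≤s (s≤s (s≤s (s≤s (s≤s z≤n)))))
      ...   | d , d≢u ∷ d≢a ∷ d≢b ∷ d≢c ∷ [] =
        contradiction (complete a≢u b≢u a-b c d (d≢c ∘ sym) c≢u c≢a c≢b d≢u d≢a d≢b)
          (near-negative (P c c≢u) (P a a≢u) (flip ac) (P d d≢u) d≢a)

      extremal : ∀ {a b} → a ≢ u → b ≢ u → Neg a b → IsExtremal Γ u a b
      extremal {a} {b} a≢u b≢u a-b =
        a≢u , b≢u , neg-≢ a-b , P a a≢u , P b b≢u , a-b ,
        (λ c c≢u c≢a c≢b → P c c≢u , isolated a≢u b≢u a-b c c≢u c≢a c≢b ,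
                           isolated b≢u a≢u (flip a-b) c c≢u c≢b c≢a) ,
        complete a≢u b≢u a-b

    -- The case of one exceptional vertex w.

    module Exception (w : Fin n) (w≢u : w ≢ u) (¬uw : ¬ Pos u w)
                     (P : ∀ v → v ≢ u → v ≢ w → Pos u v) where

      row-u : ∀ {a b s} → a ≢ u → b ≢ u → a ≢ w → b ≢ w → a ≢ b → term u w ≤ s →
        l ≤ ν - 1ℚ + (z a + z b) + s + η
      row-u {a} {b} {s} a≢u b≢u a≢w b≢w a≢b uw≤s = subst₂ _≤_ l*zu≡l
        (solve 5 (λ r η a b s →
          ((con 0ℚ :- con 1ℚ) :+ ((a :- con 1ℚ) :+ ((b :- con 1ℚ) :+ ((s :- con 1ℚ) :+ con 0ℚ)))) :+
          (con 1ℚ :+ (con 1ℚ :+ (con 1ℚ :+ r))) :* con 1ℚ :+ η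
          := r :- con 1ℚ :+ (a :+ b) :+ s :+ η) refl ν η (z a) (z b) s)
        (row-≤ u 1ℚ ((u , 0ℚ) ∷ (a , z a) ∷ (b , z b) ∷ (w , s) ∷ [])
          ((a≢u ∘ sym ∷ b≢u ∘ sym ∷ w≢u ∘ sym ∷ []) ∷ (a≢b ∷ a≢w ∷ []) ∷ (b≢w ∷ []) ∷ [] ∷ [])
          (term-refl≤0 u ∷ term≤z u a ∷ term≤z u b ∷ uw≤s ∷ [])
          (λ j _ → term≤1 u j))

      row-u-0 : ∀ {a b} → a ≢ u → b ≢ u → a ≢ w → b ≢ w → a ≢ b → l ≤ ν - 1ℚ + (z a + z b) + η
      row-u-0 {a} {b} a≢u b≢u a≢w b≢w a≢b = subst (λ s → l ≤ s + η) (ℚ.+-identityʳ (ν - 1ℚ + (z a + z b)))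
        (row-u a≢u b≢u a≢w b≢w a≢b (term≤0 u w ¬uw))

      module NegativeEdge {a b} (a≢u : a ≢ u) (b≢u : b ≢ u) (a≢w : a ≢ w) (b≢w : b ≢ w) (a-b : Neg a b) where

        private
          u+a = P a a≢u a≢w
          u+b = P b b≢u b≢w

        far : ∀ {v} → v ≢ u → v ≢ w → v ≢ b → ¬ Pos a v
        far v≢u v≢w v≢b = near-negative u+a u+b a-b (P _ v≢u v≢w) v≢b

        row-negative : l * z a ≤ 1ℚ - z b + z w + η
        row-negative = subst (l * z a ≤_)
          (solve 4 (λ b w n η →
            ((con 1ℚ :- con 0ℚ) :+ ((:- b :- con 0ℚ) :+ ((w :- con 0ℚ) :+ con 0ℚ))) :+ n :* con 0ℚ :+ η
            := con 1ℚ :- b :+ w :+ η) refl (z b) (z w) (nat n) η)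
          (row-≤ a 0ℚ ((u , 1ℚ) ∷ (b , - z b) ∷ (w , z w) ∷ [])
            ((b≢u ∘ sym ∷ w≢u ∘ sym ∷ []) ∷ (b≢w ∷ []) ∷ [] ∷ [])
            (term≤1 a u ∷ term≤-z a-b ∷ term≤z a w ∷ [])
            (λ { j (j≢u ∷ j≢b ∷ j≢w ∷ []) → term≤0 a j (far j≢u j≢w j≢b) }))

      -- A negative edge uw lowers the row of u by z w, which compensates for w in the rows of a and
      -- b. If uw is no edge, there is enough room for ν ≥ 3, and n = 5 needs one more row.
      no-negative-edge : ∀ {a b} → a ≢ u → b ≢ u → a ≢ w → b ≢ w → ¬ Neg a b
      no-negative-edge {a} {b} a≢u b≢u a≢w b≢w a-b with neg? u w
      ... | yes u-w = negative-edge-negative-w (0≤z w) A B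
        (row-u a≢u b≢u a≢w b≢w (neg-≢ a-b) (term≤-z u-w))
        where
        A = NegativeEdge.row-negative a≢u b≢u a≢w b≢w a-b
        B = NegativeEdge.row-negative b≢u a≢u b≢w a≢w (flip a-b)
      ... | no _ with nat≥3⊎nat≡2 r
      ...   | inj₁ 3≤ν = negative-edge-missing-w 3≤ν (z≤1 w)
        (NegativeEdge.row-negative a≢u b≢u a≢w b≢w a-b)
        (NegativeEdge.row-negative b≢u a≢u b≢w a≢w (flip a-b))
        (row-u-0 a≢u b≢u a≢w b≢w (neg-≢ a-b))
      -- The fifth vertex of a graph of order 5; it has no positive edge to a or b.
      ...   | inj₂ ν≡2 with avoid (u ∷ a ∷ b ∷ w ∷ []) (s≤s (s≤s (s≤s (s≤s (s≤s z≤n)))))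
      ...     | c , c≢u ∷ c≢a ∷ c≢b ∷ c≢w ∷ [] = negative-edge-five ν≡2 (z≤1 w) (z≤1 c)
        (NegativeEdge.row-negative a≢u b≢u a≢w b≢w a-b)
        (NegativeEdge.row-negative b≢u a≢u b≢w a≢w (flip a-b))
        (subst (l * z c ≤_)
          (solve 2 (λ r η →
            ((con 0ℚ :- con 1ℚ) :+ ((con 0ℚ :- con 1ℚ) :+ ((con 0ℚ :- con 1ℚ) :+ con 0ℚ))) :+
            (con 1ℚ :+ (con 1ℚ :+ (con 1ℚ :+ r))) :* con 1ℚ :+ η := r :+ η) refl ν η)
          (row-≤ c 1ℚ ((c , 0ℚ) ∷ (a , 0ℚ) ∷ (b , 0ℚ) ∷ [])
            ((c≢a ∷ c≢b ∷ []) ∷ (neg-≢ a-b ∷ []) ∷ [] ∷ [])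
            (term-refl≤0 c ∷
             term≤0 c a (NegativeEdge.far a≢u b≢u a≢w b≢w a-b c≢u c≢w c≢b ∘ flip) ∷
             term≤0 c b (NegativeEdge.far b≢u a≢u b≢w a≢w (flip a-b) c≢u c≢w c≢a ∘ flip) ∷ [])
            (λ j _ → term≤1 c j)))
        (subst₂ _≤_ l*zu≡l
          (solve 5 (λ r η a b c →
            ((con 0ℚ :- con 1ℚ) :+ ((a :- con 1ℚ) :+ ((b :- con 1ℚ) :+ ((c :- con 1ℚ) :+
              ((con 0ℚ :- con 1ℚ) :+ con 0ℚ))))) :+
            (con 1ℚ :+ (con 1ℚ :+ (con 1ℚ :+ r))) :* con 1ℚ :+ η
            := r :- con 2ℚ :+ (a :+ b :+ c) :+ η) refl ν η (z a) (z b) (z c))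
          (row-≤ u 1ℚ ((u , 0ℚ) ∷ (a , z a) ∷ (b , z b) ∷ (c , z c) ∷ (w , 0ℚ) ∷ [])
            ((a≢u ∘ sym ∷ b≢u ∘ sym ∷ c≢u ∘ sym ∷ w≢u ∘ sym ∷ []) ∷
             (neg-≢ a-b ∷ c≢a ∘ sym ∷ a≢w ∷ []) ∷ (c≢b ∘ sym ∷ b≢w ∷ []) ∷ (c≢w ∷ []) ∷ [] ∷ [])
            (term-refl≤0 u ∷ term≤z u a ∷ term≤z u b ∷ term≤z u c ∷ term≤0 u w ¬uw ∷ [])
            (λ j _ → term≤1 u j)))

      inner-positive : ∀ {v x s} → v ≢ w → x ≢ w → sign Γ v x ≡ just s → s ≡ Sign.+
      inner-positive {s = Sign.+} _ _ _ = refl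
      inner-positive {v} {x} {Sign.-} v≢w x≢w v-x with v Fin.≟ u | x Fin.≟ u
      ... | yes refl | yes refl = contradiction v-x (¬neg-refl u)
      ... | yes refl | no x≢u   = contradiction (P x x≢u x≢w) (neg⇒¬pos v-x)
      ... | no v≢u   | yes refl = contradiction (P v v≢u v≢w) (neg⇒¬pos (flip v-x))
      ... | no v≢u   | no x≢u   = contradiction v-x (no-negative-edge v≢u x≢u v≢w x≢w)

      -- All edges away from w are positive, so if those at w share one sign, switching at most w
      -- makes every edge positive.
      star-potential : ∀ s → (∀ x t → sign Γ w x ≡ just t → t ≡ s) → Potential Γ
      star-potential s at-w = q , edge
        where
        q : Fin n → Sign
        q v with v Fin.≟ w
        ... | yes _ = s
        ... | no _  = Sign.+
        edge : ∀ v x t → sign Γ v x ≡ just t → t ≡ q v Sign.* q x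
        edge v x t vx with v Fin.≟ w | x Fin.≟ w
        ... | yes refl | yes refl with () ← trans (sym (loopless Γ w)) vx
        ... | yes refl | no _     = trans (at-w x t vx) (sym (Sign.*-identityʳ s))
        ... | no _     | yes refl = at-w v t (flip vx)
        ... | no v≢w   | no x≢w   = inner-positive v≢w x≢w vx

      module Triangle (u-w : Neg u w) {a} (a≢u : a ≢ u) (w+a : Pos w a) where

        a≢w : a ≢ w
        a≢w refl = ¬pos-refl w w+a

        -- A positive edge av closes the quadrangle u, w, a, v, in which uw is the only negative
        -- edge.
        far : ∀ {v} → v ≢ u → v ≢ w → ¬ Pos a v
        far {v} v≢u v≢w a+v =
          contradiction refl (noC₄ (a≢u ∘ sym) (v≢w ∘ sym) u-w w+a a+v (flip (P v v≢u v≢w)))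

        row-a : l * z a ≤ 1ℚ + z w + η
        row-a = subst (l * z a ≤_)
          (solve 3 (λ w n η →
            ((con 1ℚ :- con 0ℚ) :+ ((w :- con 0ℚ) :+ con 0ℚ)) :+ n :* con 0ℚ :+ η
            := con 1ℚ :+ w :+ η) refl (z w) (nat n) η)
          (row-≤ a 0ℚ ((u , 1ℚ) ∷ (w , z w) ∷ [])
            ((w≢u ∘ sym ∷ []) ∷ [] ∷ [])
            (term≤1 a u ∷ term≤z a w ∷ [])
            (λ { j (j≢u ∷ j≢w ∷ []) → term≤0 a j (far j≢u j≢w) }))

      -- A positive neighbour of w has no positive neighbours besides u and w. Two of them make the
      -- row of u too small; a single one cannot sustain w against the negative edge uw.
      no-triangle : Neg u w → ∀ {a} → a ≢ u → ¬ Pos w a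
      no-triangle u-w {a} a≢u w+a with Fin.any? (λ b → ¬? (b Fin.≟ u) ×-dec ¬? (b Fin.≟ a) ×-dec pos? w b)
      ... | yes (b , b≢u , b≢a , w+b) = two-isolated (0≤z w)
        (Triangle.row-a u-w a≢u w+a) (Triangle.row-a u-w b≢u w+b)
        (row-u a≢u b≢u (Triangle.a≢w u-w a≢u w+a) (Triangle.a≢w u-w b≢u w+b) (b≢a ∘ sym) (term≤-z u-w))
      ... | no none = pendant (0≤z a) (0≤z w)
        (subst (l * z w ≤_)
          (solve 3 (λ a n η →
            ((:- con 1ℚ :- con 0ℚ) :+ ((a :- con 0ℚ) :+ con 0ℚ)) :+ n :* con 0ℚ :+ η
            := a :- con 1ℚ :+ η) refl (z a) (nat n) η)
          (row-≤ w 0ℚ ((u , - 1ℚ) ∷ (a , z a) ∷ [])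
            ((a≢u ∘ sym ∷ []) ∷ [] ∷ [])
            (subst (λ x → term w u ≤ - x) zu≡1 (term≤-z (flip u-w)) ∷ term≤z w a ∷ [])
            (λ { j (j≢u ∷ j≢a ∷ []) → term≤0 w j (λ w+j → none (j , j≢u , j≢a , w+j)) })))
        (Triangle.row-a u-w a≢u w+a)

      -- All edges at w turn out to have the same sign. A positive edge wa excludes a negative edge
      -- wx: by `no-triangle` if x is u, otherwise by `same-sign` along x, w, a.
      impossible : ⊥
      impossible with Fin.any? (λ a → ¬? (a Fin.≟ u) ×-dec pos? w a)
      ... | no none = noPotential (star-potential Sign.- at-w)
        where
        at-w : ∀ x t → sign Γ w x ≡ just t → t ≡ Sign.-
        at-w x Sign.- wx = refl
        at-w x Sign.+ wx with x Fin.≟ u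
        ... | yes refl = contradiction (flip wx) ¬uw
        ... | no x≢u   = contradiction (x , x≢u , wx) none
      ... | yes (a , a≢u , w+a) = noPotential (star-potential Sign.+ at-w)
        where
        at-w : ∀ x t → sign Γ w x ≡ just t → t ≡ Sign.+
        at-w x Sign.+ wx = refl
        at-w x Sign.- wx with x Fin.≟ u
        ... | yes refl = contradiction w+a (no-triangle (flip wx) a≢u)
        ... | no x≢u with x Fin.≟ a
        ...   | yes refl = contradiction w+a (neg⇒¬pos wx)
        ...   | no x≢a with () ← same-sign (P x x≢u (λ { refl → ¬neg-refl w wx }))
                                   (P a a≢u (λ { refl → ¬pos-refl w w+a })) x≢a w≢u (flip wx) w+a

    is-extremal : ∃[ u ] ∃[ a ] ∃[ b ] IsExtremal Γ u a b
    is-extremal with Fin.any? (λ w → ¬? (w Fin.≟ u) ×-dec ¬? (pos? u w))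
    ... | yes (w , w≢u , ¬uw) = ⊥-elim (Exception.impossible w w≢u ¬uw P)
      where
      P : ∀ v → v ≢ u → v ≢ w → Pos u v
      P v v≢u v≢w = decidable-stable (pos? u v) λ ¬uv → two-nonneighbours v≢u w≢u v≢w ¬uv ¬uw
    ... | no none with Fin.any? (λ a → Fin.any? (λ b → ¬? (a Fin.≟ u) ×-dec ¬? (b Fin.≟ u) ×-dec neg? a b))
    ...   | yes (a , b , a≢u , b≢u , a-b) = u , a , b , NoException.extremal P a≢u b≢u a-b
      where
      P : ∀ v → v ≢ u → Pos u v
      P v v≢u = decidable-stable (pos? u v) λ ¬uv → none (v , v≢u , ¬uv)
    ...   | no noNegative = contradiction ((λ _ → Sign.+) , all-positive) noPotential
      where
      all-positive : ∀ v x s → sign Γ v x ≡ just s → s ≡ Sign.+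
      all-positive v x Sign.+ _ = refl
      all-positive v x Sign.- v-x with v Fin.≟ u | x Fin.≟ u
      ... | no v≢u   | no x≢u   = contradiction (v , x , v≢u , x≢u , v-x) noNegative
      ... | yes refl | yes refl = contradiction v-x (¬neg-refl u)
      ... | yes refl | no x≢u   = contradiction (x , x≢u , neg⇒¬pos v-x) none
      ... | no v≢u   | yes refl = contradiction (v , v≢u , neg⇒¬pos (flip v-x)) none

open ExtremalStructure

-- Potentials and balance, quadrangles, switching, and the isomorphism with Γ₁.

module Switching where

  open import Data.Sign using (opposite; _*_)

  parity : ℕ → Sign
  parity zero    = Sign.+
  parity (suc n) = opposite (parity n)

  2∣⇒parity≡+ : ∀ {n} → 2 ∣ n → parity n ≡ Sign.+
  2∣⇒parity≡+ (divides q refl) = double q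
    where
    double : ∀ q → parity (q ℕ.* 2) ≡ Sign.+
    double zero    = refl
    double (suc q) = cong (opposite ∘ opposite) (double q)

  parity≡+⇒2∣ : ∀ n → parity n ≡ Sign.+ → 2 ∣ n
  parity≡+⇒2∣ zero          _    = 2 ∣0
  parity≡+⇒2∣ (suc (suc n)) even =
    ∣m∣n⇒∣m+n ∣-refl (parity≡+⇒2∣ n (trans (sym (Sign.opposite-involutive (parity n))) even))

  signProduct : List Sign → Sign
  signProduct = List.foldr _*_ Sign.+

  parity-#negative : ∀ {A : Set} (f : A → Maybe Sign) (t : A → Sign) → (∀ i → f i ≡ just (t i)) → ∀ is →
    parity (length (filter (λ i → ≡-dec Sign._≟_ (f i) (just Sign.-)) is)) ≡ signProduct (map t is)
  parity-#negative f t f≡t []       = refl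
  parity-#negative f t f≡t (i ∷ is) with t i in ti
  ... | Sign.-
    rewrite filter-accept (λ i → ≡-dec Sign._≟_ (f i) (just Sign.-)) {i} {is} (trans (f≡t i) (cong just ti))
    = cong opposite (parity-#negative f t f≡t is)
  ... | Sign.+
    rewrite filter-reject (λ i → ≡-dec Sign._≟_ (f i) (just Sign.-)) {i} {is}
              (λ neg → contradiction (trans (sym neg) (trans (f≡t i) (cong just ti))) λ ())
    = parity-#negative f t f≡t is

  telescope : ∀ k (h : ℕ → Sign) →
    signProduct (tabulate {n = k} (λ i → h (toℕ i) * h (suc (toℕ i)))) ≡ h 0 * h k
  telescope zero    h = sym (Sign.s*s≡+ (h 0))
  telescope (suc k) h = begin
    h 0 * h 1 * signProduct (tabulate {n = k} (λ i → h (suc (toℕ i)) * h (suc (suc (toℕ i)))))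
      ≡⟨ cong (h 0 * h 1 *_) (telescope k (h ∘ suc)) ⟩
    h 0 * h 1 * (h 1 * h (suc k))    ≡⟨ Sign.*-assoc (h 0) (h 1) _ ⟩
    h 0 * (h 1 * (h 1 * h (suc k)))  ≡⟨ cong (h 0 *_) (Sign.*-assoc (h 1) (h 1) _) ⟨
    h 0 * (h 1 * h 1 * h (suc k))    ≡⟨ cong (λ s → h 0 * (s * h (suc k))) (Sign.s*s≡+ (h 1)) ⟩
    h 0 * h (suc k)                  ∎
    where open ≡-Reasoning

  toℕ-mod : ∀ {k} .{{_ : NonZero k}} (i : Fin k) → toℕ i mod k ≡ i
  toℕ-mod {k} i = Fin.toℕ-injective
    (trans (Fin.toℕ-fromℕ< (m%n<n (toℕ i) k)) (m<n⇒m%n≡m (Fin.toℕ<n i)))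

  n-mod-n : ∀ k .{{_ : NonZero k}} → k mod k ≡ 0 mod k
  n-mod-n k@(suc _) = Fin.toℕ-injective
    (trans (Fin.toℕ-fromℕ< (m%n<n k k)) (trans (n%n≡0 k) (sym (Fin.toℕ-fromℕ< (m%n<n 0 k)))))

  potential⇒balanced : ∀ {n} (Γ : SignedGraph n) → Potential Γ → Balanced Γ
  potential⇒balanced {n} Γ (q , potential) k C = parity≡+⇒2∣ #negativeEdges (begin
    parity #negativeEdges               ≡⟨ parity-#negative edgeSign t edge (allFin k) ⟩
    signProduct (map t (allFin k))      ≡⟨ cong signProduct (map-tabulate id t) ⟩
    signProduct (tabulate t)            ≡⟨ cong signProduct (tabulate-cong λ i →
                                             cong (λ j → q (vertex j) * h (suc (toℕ i))) (sym (toℕ-mod i))) ⟩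
    signProduct (tabulate {n = k} λ i → h (toℕ i) * h (suc (toℕ i)))  ≡⟨ telescope k h ⟩
    h 0 * h k                           ≡⟨ cong (λ j → h 0 * q (vertex j)) (n-mod-n k) ⟩
    h 0 * h 0                           ≡⟨ Sign.s*s≡+ (h 0) ⟩
    Sign.+                              ∎)
    where
    open Cycle C
    open ≡-Reasoning
    -- Reading vertices modulo k turns `next` into the successor; the telescoped product is then h 0
    -- * h k with h k equal to h 0.
    h : ℕ → Sign
    h j = q (vertex (j mod k))
    t : Fin k → Sign
    t i = q (vertex i) * q (vertex (next i))
    edge : ∀ i → edgeSign i ≡ just (t i)
    edge i with edgeSign i in eq | adjacent i
    ... | just s | _ = cong just (potential _ _ s eq)

  quadrangle : Maybe Sign → Maybe Sign → Maybe Sign → Maybe Sign → Maybe Sign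
  quadrangle s t p q = zipWith _*_ s (zipWith _*_ t (zipWith _*_ p q))

  quadrangle⇒C₄ : ∀ {n} (Γ : SignedGraph n) {a b c d s t p q} → a ≢ c → b ≢ d →
    sign Γ a b ≡ just s → sign Γ b c ≡ just t → sign Γ c d ≡ just p → sign Γ d a ≡ just q →
    s * (t * (p * q)) ≡ Sign.- → HasNegativeC₄ Γ
  quadrangle⇒C₄ {n} Γ {a} {b} {c} {d} {s} {t} {p} {q} a≢c b≢d ab bc cd da negative = C , λ even →
    contradiction (begin
      Sign.+                                   ≡⟨ 2∣⇒parity≡+ even ⟨
      parity (Cycle.#negativeEdges C)          ≡⟨ parity-#negative (Cycle.edgeSign C) signs edge (allFin 4) ⟩
      s * (t * (p * (q * Sign.+)))             ≡⟨ cong (λ x → s * (t * (p * x))) (Sign.*-identityʳ q) ⟩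
      s * (t * (p * q))                        ≡⟨ negative ⟩
      Sign.-                                   ∎) λ ()
    where
    open ≡-Reasoning
    vertices = a Vec.∷ b Vec.∷ c Vec.∷ d Vec.∷ Vec.[]
    signs : Fin 4 → Sign
    signs = Vec.lookup (s Vec.∷ t Vec.∷ p Vec.∷ q Vec.∷ Vec.[])
    edge : ∀ i → sign Γ (Vec.lookup vertices i) (Vec.lookup vertices (next i)) ≡ just (signs i)
    edge zero                   = ab
    edge (suc zero)             = bc
    edge (suc (suc zero))       = cd
    edge (suc (suc (suc zero))) = da
    ends-≢ : ∀ {v w x} → sign Γ v w ≡ just x → v ≢ w
    ends-≢ {v} vw refl with () ← trans (sym (loopless Γ v)) vw
    C : Cycle Γ 4
    C = record
      { 3≤k       = s≤s (s≤s (s≤s z≤n))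
      ; vertex    = Vec.lookup vertices
      ; injective = λ {i} {j} → lookup-injective
          ((ends-≢ ab ∷ a≢c ∷ ends-≢ da ∘ sym ∷ []) ∷ (ends-≢ bc ∷ b≢d ∷ []) ∷ (ends-≢ cd ∷ []) ∷ [] ∷ []) i j
      ; adjacent  = λ i → subst Maybe.Is-just (sym (edge i)) (just tt)
      }

  -- `zipWith` yields `nothing` as soon as an edge is missing, so a single decidable equation says
  -- both that the quadrangle exists and that it is negative.
  NegativeQuadrangle : ∀ {n} → SignedGraph n → Set
  NegativeQuadrangle Γ = ∃[ a ] ∃[ b ] ∃[ c ] ∃[ d ] a ≢ c × b ≢ d ×
    quadrangle (sign Γ a b) (sign Γ b c) (sign Γ c d) (sign Γ d a) ≡ just Sign.-

  negativeQuadrangle? : ∀ {n} (Γ : SignedGraph n) → Dec (NegativeQuadrangle Γ)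
  negativeQuadrangle? Γ = Fin.any? λ a → Fin.any? λ b → Fin.any? λ c → Fin.any? λ d →
    ¬? (a Fin.≟ c) ×-dec ¬? (b Fin.≟ d) ×-dec
    ≡-dec Sign._≟_ (quadrangle (sign Γ a b) (sign Γ b c) (sign Γ c d) (sign Γ d a)) (just Sign.-)

  noNegativeQuadrangle : ∀ {n} (Γ : SignedGraph n) → ¬ NegativeQuadrangle Γ → NoNegativeQuadrangle Γ
  noNegativeQuadrangle Γ none {a} {b} {c} {d} a≢c b≢d ab bc cd da negative =
    none (a , b , c , d , a≢c , b≢d , eq)
    where
    eq : quadrangle (sign Γ a b) (sign Γ b c) (sign Γ c d) (sign Γ d a) ≡ just Sign.-
    eq rewrite ab | bc | cd | da = cong just negative

  -- The spectral argument yields only a contradiction; the finite search extracts an actual cycle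
  -- from it.
  hasNegativeC₄ : ∀ {n} (Γ : SignedGraph n) → ¬ NoNegativeQuadrangle Γ → HasNegativeC₄ Γ
  hasNegativeC₄ Γ some
    with a , b , c , d , a≢c , b≢d , negative ←
           decidable-stable (negativeQuadrangle? Γ) (some ∘ noNegativeQuadrangle Γ)
    with sign Γ a b in ab | sign Γ b c in bc | sign Γ c d in cd | sign Γ d a in da
  ... | just s | just t | just p | just q = quadrangle⇒C₄ Γ a≢c b≢d ab bc cd da (just-injective negative)

  sideSign : Bool → Sign
  sideSign true  = Sign.-
  sideSign false = Sign.+

  side : ∀ {n} → Subset n → Fin n → Sign
  side U v = sideSign (Vec.lookup U v)

  -- Switching is conjugation by the diagonal matrix of side signs. In this form it is handled by
  -- sign algebra instead of case splits.
  switchedSign≡ : ∀ {n} (U : Subset n) (Γ : SignedGraph n) u v →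
    switchedSign U Γ u v ≡ Maybe.map (λ s → side U u * (s * side U v)) (sign Γ u v)
  switchedSign≡ U Γ u v with Vec.lookup U u | Vec.lookup U v | sign Γ u v
  ... | true  | true  | nothing     = refl
  ... | true  | false | nothing     = refl
  ... | false | true  | nothing     = refl
  ... | false | false | nothing     = refl
  ... | true  | true  | just Sign.+ = refl
  ... | true  | true  | just Sign.- = refl
  ... | true  | false | just Sign.+ = refl
  ... | true  | false | just Sign.- = refl
  ... | false | true  | just Sign.+ = refl
  ... | false | true  | just Sign.- = refl
  ... | false | false | just Sign.+ = refl
  ... | false | false | just Sign.- = refl

  flank-comm : ∀ x s y → x * (s * y) ≡ y * (s * x)
  flank-comm x s y = trans (Sign.*-comm x (s * y))
    (trans (cong (_* x) (Sign.*-comm s y)) (Sign.*-assoc y s x))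

  flank-flank : ∀ x s y → x * ((x * (s * y)) * y) ≡ s
  flank-flank x s y = begin
    x * ((x * (s * y)) * y)    ≡⟨ cong (x *_) (Sign.*-assoc x (s * y) y) ⟩
    x * (x * ((s * y) * y))    ≡⟨ Sign.*-assoc x x _ ⟨
    (x * x) * ((s * y) * y)    ≡⟨ cong₂ _*_ (Sign.s*s≡+ x) (Sign.*-assoc s y y) ⟩
    s * (y * y)                ≡⟨ cong (s *_) (Sign.s*s≡+ y) ⟩
    s * Sign.+                 ≡⟨ Sign.*-identityʳ s ⟩
    s                          ∎
    where open ≡-Reasoning

  flank-* : ∀ x s y t z → (x * (s * y)) * (y * (t * z)) ≡ x * ((s * t) * z)
  flank-* x s y t z = begin
    (x * (s * y)) * (y * (t * z))  ≡⟨ Sign.*-assoc x (s * y) _ ⟩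
    x * ((s * y) * (y * (t * z)))  ≡⟨ cong (x *_) (Sign.*-assoc s y _) ⟩
    x * (s * (y * (y * (t * z))))  ≡⟨ cong (λ e → x * (s * e)) (Sign.*-assoc y y _) ⟨
    x * (s * ((y * y) * (t * z)))  ≡⟨ cong (λ e → x * (s * (e * (t * z)))) (Sign.s*s≡+ y) ⟩
    x * (s * (t * z))              ≡⟨ cong (x *_) (Sign.*-assoc s t z) ⟨
    x * ((s * t) * z)              ∎
    where open ≡-Reasoning

  switch : ∀ {n} → Subset n → SignedGraph n → SignedGraph n
  switch U Γ = record
    { sign     = switchedSign U Γ
    ; sign-sym = λ u v → trans (switchedSign≡ U Γ u v) (trans
        (trans (cong (Maybe.map _) (sign-sym Γ u v)) (map-comm (side U u) (side U v) (sign Γ v u))) (sym (switchedSign≡ U Γ v u)))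
    ; loopless = λ v → trans (switchedSign≡ U Γ v v) (cong (Maybe.map _) (loopless Γ v))
    }
    where
    map-comm : ∀ x y m → Maybe.map (λ s → x * (s * y)) m ≡ Maybe.map (λ s → y * (s * x)) m
    map-comm x y nothing  = refl
    map-comm x y (just s) = cong just (flank-comm x s y)

  module _ {n} (U : Subset n) (Γ : SignedGraph n) where

    private
      p = side U

    sign-switch : ∀ {u v s} → sign Γ u v ≡ just s → sign (switch U Γ) u v ≡ just (p u * (s * p v))
    sign-switch {u} {v} uv = trans (switchedSign≡ U Γ u v) (cong (Maybe.map _) uv)

    sign-unswitch : ∀ {u v s} → sign (switch U Γ) u v ≡ just s → sign Γ u v ≡ just (p u * (s * p v))
    sign-unswitch {u} {v} {s} uv with sign Γ u v | trans (sym (switchedSign≡ U Γ u v)) uv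
    ... | just t | eq = cong just (trans (sym (flank-flank (p u) t (p v)))
                                         (cong (λ e → p u * (e * p v)) (just-injective eq)))

    switch-potential : Potential (switch U Γ) → Potential Γ
    switch-potential (q , potential) = (λ v → p v * q v) , λ u v s uv → begin
      s                                ≡⟨ flank-flank (p u) s (p v) ⟨
      p u * ((p u * (s * p v)) * p v)  ≡⟨ cong (λ e → p u * (e * p v)) (potential u v _ (sign-switch uv)) ⟩
      p u * ((q u * q v) * p v)        ≡⟨ cong (p u *_) (Sign.*-assoc (q u) (q v) (p v)) ⟩
      p u * (q u * (q v * p v))        ≡⟨ Sign.*-assoc (p u) (q u) _ ⟨
      (p u * q u) * (q v * p v)        ≡⟨ cong (p u * q u *_) (Sign.*-comm (q v) (p v)) ⟩
      (p u * q u) * (p v * q v)        ∎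
      where open ≡-Reasoning

    -- Each vertex of a closed walk contributes its side sign twice, so the product of the edge
    -- signs is unchanged.
    switch-noC₄ : NoNegativeQuadrangle Γ → NoNegativeQuadrangle (switch U Γ)
    switch-noC₄ noC₄ {a} {b} {c} {d} {s} {t} {x} {y} a≢c b≢d ab bc cd da negative =
      noC₄ a≢c b≢d (sign-unswitch ab) (sign-unswitch bc) (sign-unswitch cd) (sign-unswitch da) (begin
        F a s b * (F b t c * (F c x d * F d y a))  ≡⟨ cong (λ e → F a s b * (F b t c * e)) (flank-* (p c) x (p d) y (p a)) ⟩
        F a s b * (F b t c * F c (x * y) a)        ≡⟨ cong (F a s b *_) (flank-* (p b) t (p c) (x * y) (p a)) ⟩
        F a s b * F b (t * (x * y)) a              ≡⟨ flank-* (p a) s (p b) (t * (x * y)) (p a) ⟩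
        F a (s * (t * (x * y))) a                  ≡⟨ cong (λ e → F a e a) negative ⟩
        F a Sign.- a                               ≡⟨ flank-comm (p a) Sign.- (p a) ⟩
        F a Sign.- a                               ≡⟨ conjugate (p a) ⟩
        Sign.-                                     ∎)
      where
      open ≡-Reasoning
      F : Fin n → Sign → Fin n → Sign
      F u s v = p u * (s * p v)
      conjugate : ∀ x → x * (Sign.- * x) ≡ Sign.-
      conjugate Sign.+ = refl
      conjugate Sign.- = refl

  transpose-ˡ : ∀ {n} (i j : Fin n) → transpose i j ⟨$⟩ʳ i ≡ j
  transpose-ˡ i j rewrite dec-true (i Fin.≟ i) refl = refl

  transpose-other : ∀ {n} (i j : Fin n) {k} → k ≢ i → k ≢ j → transpose i j ⟨$⟩ʳ k ≡ k
  transpose-other i j {k} k≢i k≢j rewrite dec-false (k Fin.≟ i) k≢i | dec-false (k Fin.≟ j) k≢j = refl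

  ⟨$⟩ʳ-injective : ∀ {n} (π : Permutation′ n) {i j} → π ⟨$⟩ʳ i ≡ π ⟨$⟩ʳ j → i ≡ j
  ⟨$⟩ʳ-injective π eq = trans (sym (inverseˡ π)) (trans (cong (π ⟨$⟩ˡ_) eq) (inverseˡ π))

  -- Three transpositions, each applied to the images left by the earlier ones. It must fix the
  -- positions already settled, which is the purpose of `b₁≢0`, `u₂≢0` and `u₂≢1`.
  first-three : ∀ {r} {a b u : Fin (3 ℕ.+ r)} → a ≢ b → a ≢ u → b ≢ u →
    ∃ λ (π : Permutation′ (3 ℕ.+ r)) →
      π ⟨$⟩ʳ a ≡ zero × π ⟨$⟩ʳ b ≡ suc zero × π ⟨$⟩ʳ u ≡ suc (suc zero)
  first-three {r} {a} {b} {u} a≢b a≢u b≢u = π₁ ∘ₚ (π₂ ∘ₚ π₃) ,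
    trans (cong (λ i → π₃ ⟨$⟩ʳ (π₂ ⟨$⟩ʳ i)) (transpose-ˡ a zero))
      (trans (cong (π₃ ⟨$⟩ʳ_) (transpose-other b₁ (suc zero) (b₁≢0 ∘ sym) λ ()))
             (transpose-other u₂ (suc (suc zero)) (u₂≢0 ∘ sym) λ ())) ,
    trans (cong (π₃ ⟨$⟩ʳ_) (transpose-ˡ b₁ (suc zero)))
      (transpose-other u₂ (suc (suc zero)) (u₂≢1 ∘ sym) λ ()) ,
    transpose-ˡ u₂ (suc (suc zero))
    where
    π₁ = transpose a zero
    b₁ = π₁ ⟨$⟩ʳ b
    π₂ = transpose b₁ (suc zero)
    u₂ = π₂ ⟨$⟩ʳ (π₁ ⟨$⟩ʳ u)
    π₃ = transpose u₂ (suc (suc zero))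
    b₁≢0 : b₁ ≢ zero
    b₁≢0 eq = a≢b (⟨$⟩ʳ-injective π₁ (trans (transpose-ˡ a zero) (sym eq)))
    u₂≢1 : u₂ ≢ suc zero
    u₂≢1 eq = b≢u (⟨$⟩ʳ-injective (π₁ ∘ₚ π₂) (trans (transpose-ˡ b₁ (suc zero)) (sym eq)))
    u₂≢0 : u₂ ≢ zero
    u₂≢0 eq = a≢u (⟨$⟩ʳ-injective (π₁ ∘ₚ π₂) (trans (cong (π₂ ⟨$⟩ʳ_) (transpose-ˡ a zero))
      (trans (transpose-other b₁ (suc zero) (b₁≢0 ∘ sym) λ ()) (sym eq))))

  data Place {n} (a b u v : Fin n) : Set where
    first  : v ≡ a → Place a b u v
    second : v ≡ b → Place a b u v
    third  : v ≡ u → Place a b u v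
    other  : v ≢ a → v ≢ b → v ≢ u → Place a b u v

  place : ∀ {n} (a b u v : Fin n) → Place a b u v
  place a b u v with v Fin.≟ a | v Fin.≟ b | v Fin.≟ u
  ... | yes v≡a | _       | _       = first v≡a
  ... | no _    | yes v≡b | _       = second v≡b
  ... | no _    | no _    | yes v≡u = third v≡u
  ... | no v≢a  | no v≢b  | no v≢u  = other v≢a v≢b v≢u

  extremal⇒≅Γ₁ : ∀ {r} (Γ : SignedGraph (3 ℕ.+ r)) {u a b} → IsExtremal Γ u a b → Γ ≅ Γ₁ (3 ℕ.+ r)
  extremal⇒≅Γ₁ {r} Γ {u} {a} {b} (a≢u , b≢u , a≢b , ua , ub , ab , rest , clique) =
    π , λ v w → same v w (place a b u v) (place a b u w)
    where
    n = 3 ℕ.+ r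
    arrangement = first-three a≢b a≢u b≢u
    π  = proj₁ arrangement
    πa = proj₁ (proj₂ arrangement)
    πb = proj₁ (proj₂ (proj₂ arrangement))
    πu = proj₂ (proj₂ (proj₂ arrangement))

    flip : ∀ {v w s} → sign Γ v w ≡ s → sign Γ w v ≡ s
    flip {v} {w} = trans (sign-sym Γ w v)

    position : ∀ {v} → v ≢ a → v ≢ b → v ≢ u → ∃ λ k → π ⟨$⟩ʳ v ≡ suc (suc (suc k))
    position {v} v≢a v≢b v≢u with π ⟨$⟩ʳ v in eq
    ... | zero              = contradiction (⟨$⟩ʳ-injective π (trans eq (sym πa))) v≢a
    ... | suc zero          = contradiction (⟨$⟩ʳ-injective π (trans eq (sym πb))) v≢b
    ... | suc (suc zero)    = contradiction (⟨$⟩ʳ-injective π (trans eq (sym πu))) v≢u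
    ... | suc (suc (suc k)) = k , refl

    -- Replaces both images by constructor forms, on which `Γ₁-sign` computes.
    at : ∀ {v w i j} → π ⟨$⟩ʳ v ≡ i → π ⟨$⟩ʳ w ≡ j →
      sign Γ v w ≡ sign (Γ₁ n) i j → sign Γ v w ≡ sign (Γ₁ n) (π ⟨$⟩ʳ v) (π ⟨$⟩ʳ w)
    at refl refl eq = eq

    diagonal : ∀ v → sign Γ v v ≡ sign (Γ₁ n) (π ⟨$⟩ʳ v) (π ⟨$⟩ʳ v)
    diagonal v = trans (loopless Γ v) (sym (loopless (Γ₁ n) (π ⟨$⟩ʳ v)))

    same : ∀ v w → Place a b u v → Place a b u w → sign Γ v w ≡ sign (Γ₁ n) (π ⟨$⟩ʳ v) (π ⟨$⟩ʳ w)
    same v w (first refl)  (first refl)  = diagonal v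
    same v w (first refl)  (second refl) = at πa πb ab
    same v w (first refl)  (third refl)  = at πa πu (flip ua)
    same v w (second refl) (first refl)  = at πb πa (flip ab)
    same v w (second refl) (second refl) = diagonal v
    same v w (second refl) (third refl)  = at πb πu (flip ub)
    same v w (third refl)  (first refl)  = at πu πa ua
    same v w (third refl)  (second refl) = at πu πb ub
    same v w (third refl)  (third refl)  = diagonal v
    same v w (first refl)  (other w≢a w≢b w≢u) =
      at πa (proj₂ (position w≢a w≢b w≢u)) (proj₁ (proj₂ (rest w w≢u w≢a w≢b)))
    same v w (second refl) (other w≢a w≢b w≢u) =
      at πb (proj₂ (position w≢a w≢b w≢u)) (proj₂ (proj₂ (rest w w≢u w≢a w≢b)))
    same v w (third refl)  (other w≢a w≢b w≢u) =
      at πu (proj₂ (position w≢a w≢b w≢u)) (proj₁ (rest w w≢u w≢a w≢b))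
    same v w (other v≢a v≢b v≢u) (first refl)  =
      at (proj₂ (position v≢a v≢b v≢u)) πa (flip (proj₁ (proj₂ (rest v v≢u v≢a v≢b))))
    same v w (other v≢a v≢b v≢u) (second refl) =
      at (proj₂ (position v≢a v≢b v≢u)) πb (flip (proj₂ (proj₂ (rest v v≢u v≢a v≢b))))
    same v w (other v≢a v≢b v≢u) (third refl)  =
      at (proj₂ (position v≢a v≢b v≢u)) πu (flip (proj₁ (rest v v≢u v≢a v≢b)))
    same v w (other v≢a v≢b v≢u) (other w≢a w≢b w≢u)
      with position v≢a v≢b v≢u | position w≢a w≢b w≢u | v Fin.≟ w
    ... | _ | _ | yes refl = diagonal v
    ... | i , πv | j , πw | no v≢w = at πv πw (trans (clique v w v≢w v≢u v≢a v≢b w≢u w≢a w≢b)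
      (sym (cong (if_then nothing else just Sign.+) (dec-false (toℕ i ℕ.≟ toℕ j) i≢j))))
      where
      i≢j : toℕ i ≢ toℕ j
      i≢j eq = v≢w (⟨$⟩ʳ-injective π
        (trans πv (trans (cong (λ k → suc (suc (suc k))) (Fin.toℕ-injective eq)) (sym πw))))

open Switching

-- From a real eigenvector to a rational approximate one.

module Approximation where

  open import Data.Rational
  open +-*-Solver using (solve; con; _:+_; _:*_; _:-_; :-_; _:=_)

  Eventually : (ℕ → Set) → Set
  Eventually P = ∃[ N ] ∀ k → N ℕ.≤ k → P k

  eventually-both : ∀ {P Q : ℕ → Set} → Eventually P → Eventually Q → Eventually (λ k → P k × Q k)
  eventually-both (M , p) (N , q) = M ℕ.⊔ N , λ k ≤k →
    p k (ℕ.m⊔n≤o⇒m≤o M N ≤k) , q k (ℕ.m⊔n≤o⇒n≤o M N ≤k)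

  eventually-all : ∀ {n} {P : Fin n → ℕ → Set} → (∀ i → Eventually (P i)) → Eventually (λ k → ∀ i → P i k)
  eventually-all {zero}  _ = 0 , λ _ _ ()
  eventually-all {suc n} p with eventually-both (p zero) (eventually-all (p ∘ suc))
  ... | N , both = N , λ { k ≤k zero → proj₁ (both k ≤k) ; k ≤k (suc i) → proj₂ (both k ≤k) i }

  signed : Sign → ℚ
  signed Sign.+ = 1ℚ
  signed Sign.- = - 1ℚ

  -signed*p≤∣p∣ : ∀ s p → - (signed s * p) ≤ ∣ p ∣
  -signed*p≤∣p∣ Sign.+ p = subst₂ _≤_ (cong -_ (sym (ℚ.*-identityˡ p))) (ℚ.∣-p∣≡∣p∣ p) (p≤∣p∣ (- p))
  -signed*p≤∣p∣ Sign.- p = subst (_≤ ∣ p ∣)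
    (solve 1 (λ p → p := :- (con (- 1ℚ) :* p)) refl p) (p≤∣p∣ p)

  weight-flank : ∀ s m t → weight (Maybe.map (λ e → s Sign.* (e Sign.* t)) m) ≡ signed s * (weight m * signed t)
  weight-flank Sign.+ nothing       Sign.+ = refl
  weight-flank Sign.+ nothing       Sign.- = refl
  weight-flank Sign.- nothing       Sign.+ = refl
  weight-flank Sign.- nothing       Sign.- = refl
  weight-flank Sign.+ (just Sign.+) Sign.+ = refl
  weight-flank Sign.+ (just Sign.+) Sign.- = refl
  weight-flank Sign.+ (just Sign.-) Sign.+ = refl
  weight-flank Sign.+ (just Sign.-) Sign.- = refl
  weight-flank Sign.- (just Sign.+) Sign.+ = refl
  weight-flank Sign.- (just Sign.+) Sign.- = refl
  weight-flank Sign.- (just Sign.-) Sign.+ = refl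
  weight-flank Sign.- (just Sign.-) Sign.- = refl

  seq-sum : ∀ {n} (f : Fin n → ℝ) (g : Fin n → ℚ) k → (∀ j → seq (f j) k ≡ g j) →
    seq (foldr Defs._+_ 0ℝ f) k ≡ ∑ g
  seq-sum {zero}  f g k f≡g = refl
  seq-sum {suc n} f g k f≡g = cong₂ _+_ (f≡g zero) (seq-sum (f ∘ suc) (g ∘ suc) k (f≡g ∘ suc))

  seq-entry : ∀ s k → seq (entry s) k ≡ weight s
  seq-entry nothing       k = refl
  seq-entry (just Sign.+) k = refl
  seq-entry (just Sign.-) k = refl

  seq-adjacency*ᵥ : ∀ {n} (Γ : SignedGraph n) x i k →
    seq ((adjacencyMatrix Γ *ᵥ x) i) k ≡ ∑ (λ j → weight (sign Γ i j) * seq (x j) k)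
  seq-adjacency*ᵥ Γ x i k = seq-sum
    (λ j → adjacencyMatrix Γ i j Defs.* x j) (λ j → weight (sign Γ i j) * seq (x j) k) k
    (λ j → cong (_* seq (x j) k) (seq-entry (sign Γ i j) k))

  ½*-positive : ∀ {ε} → 0ℚ < ε → 0ℚ < ½ * ε
  ½*-positive = 0<* (ℚ.positive⁻¹ ½)

  -- Proving ⊥, one may use a coordinate bounded away from 0 although none can be
  -- found constructively.
  apart : ∀ {n} (x : Fin n → ℝ) → ¬ (∀ i → x i ≈ 0ℝ) →
    (∀ i ε → 0ℚ < ε → Eventually (λ k → ε ≤ ∣ seq (x i) k ∣) → ⊥) → ⊥
  apart x x≉0 none = x≉0 vanishes
    where
    vanishes : ∀ i → x i ≈ 0ℝ
    vanishes i ε 0<ε with cauchy (x i) (½ * (½ * ε)) (½*-positive (½*-positive 0<ε))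
    -- One comparison settles all later indices: their terms are within ε/4 of this one, hence stay
    -- below ε or above ε/4.
    ... | N , close with ∣ seq (x i) N ∣ <? ½ * ε
    ...   | yes small = N , λ k N≤k → let a = seq (x i) k ; b = seq (x i) N in begin-strict
      ∣ a - 0ℚ ∣                   ≡⟨ cong ∣_∣ (solve 2 (λ a b → a :- con 0ℚ := (a :- b) :+ b) refl a b) ⟩
      ∣ (a - b) + b ∣              ≤⟨ ℚ.∣p+q∣≤∣p∣+∣q∣ (a - b) b ⟩
      ∣ a - b ∣ + ∣ b ∣            <⟨ ℚ.+-mono-< (close k N N≤k ℕ.≤-refl) small ⟩
      ½ * (½ * ε) + ½ * ε          ≤⟨ ungap (subst (0ℚ ≤_)
                                       (solve 1 (λ e → con ½ :* (con ½ :* e) :=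
                                          e :- (con ½ :* (con ½ :* e) :+ con ½ :* e)) refl ε)
                                       (ℚ.<⇒≤ (½*-positive (½*-positive 0<ε)))) ⟩
      ε                            ∎
      where open ℚ.≤-Reasoning
    ...   | no large = ⊥-elim (none i (½ * (½ * ε)) (½*-positive (½*-positive 0<ε))
      (N , λ k N≤k → let a = seq (x i) k ; b = seq (x i) N in
        ungap (subst (0ℚ ≤_)
          (solve 2 (λ e a → (con ½ :* (con ½ :* e) :+ a) :- con ½ :* e := a :- con ½ :* (con ½ :* e)) refl ε ∣ a ∣)
          (gap (begin
            ½ * ε                      ≤⟨ ℚ.≮⇒≥ large ⟩
            ∣ b ∣                      ≡⟨ cong ∣_∣ (solve 2 (λ a b → b := (b :- a) :+ a) refl a b) ⟩
            ∣ (b - a) + a ∣            ≤⟨ ℚ.∣p+q∣≤∣p∣+∣q∣ (b - a) a ⟩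
            ∣ b - a ∣ + ∣ a ∣          ≤⟨ ℚ.+-monoˡ-≤ ∣ a ∣ (ℚ.<⇒≤ (close N k ℕ.≤-refl N≤k)) ⟩
            ½ * (½ * ε) + ∣ a ∣        ∎)))))
      where open ℚ.≤-Reasoning

  maximum : ∀ {n} → Fin n → (f : Fin n → ℚ) → ∃[ u ] ∀ v → f v ≤ f u
  maximum {suc zero}    _ f = zero , λ { zero → ℚ.≤-refl }
  maximum {suc (suc n)} _ f with maximum zero (f ∘ suc)
  ... | u , max with ℚ.≤-total (f zero) (f (suc u))
  ...   | inj₁ f0≤fu = suc u , λ { zero → f0≤fu ; (suc v) → max v }
  ...   | inj₂ fu≤f0 = zero , λ { zero → ℚ.≤-refl ; (suc v) → ℚ.≤-trans (max v) fu≤f0 }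

  negatives : ∀ {n} → (Fin n → ℚ) → Subset n
  negatives y = Vec.tabulate (λ v → does (y v <? 0ℚ))

  side-negatives : ∀ {n} (y : Fin n → ℚ) v → signed (side (negatives y) v) * y v ≡ ∣ y v ∣
  side-negatives y v = trans
    (cong (λ b → signed (sideSign b) * y v) (lookup∘tabulate (λ v → does (y v <? 0ℚ)) v)) (abs (y v <? 0ℚ))
    where
    abs : (yv<0? : Dec (y v < 0ℚ)) → signed (sideSign (does yv<0?)) * y v ≡ ∣ y v ∣
    abs (yes yv<0) = trans (solve 1 (λ p → con (- 1ℚ) :* p := :- p) refl (y v))
      (trans (sym (ℚ.0≤p⇒∣p∣≡p (subst (0ℚ ≤_) (ℚ.+-identityˡ (- y v)) (gap (ℚ.<⇒≤ yv<0))))) (ℚ.∣-p∣≡∣p∣ (y v)))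
    abs (no yv≮0)  = trans (ℚ.*-identityˡ (y v)) (sym (ℚ.0≤p⇒∣p∣≡p (ℚ.≮⇒≥ yv≮0)))

  signed*signed : ∀ s → signed s * signed s ≡ 1ℚ
  signed*signed Sign.+ = refl
  signed*signed Sign.- = refl

  switched-term≡ : ∀ s w t y c → t * t ≡ 1ℚ → s * (w * t) * (t * y * c) ≡ (s * c) * (w * y)
  switched-term≡ s w t y c t*t≡1 = trans
    (solve 5 (λ s w t y c → s :* (w :* t) :* (t :* y :* c) := (t :* t) :* ((s :* c) :* (w :* y))) refl s w t y c)
    (trans (cong (_* ((s * c) * (w * y))) t*t≡1) (ℚ.*-identityˡ _))

  split-residual : ∀ l s y c σ → l * (s * y * c) ≡ (s * c) * σ + - (s * (σ - l * y)) * c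
  split-residual = solve 5 (λ l s y c σ → l :* (s :* y :* c) := (s :* c) :* σ :+ :- (s :* (σ :- l :* y)) :* c) refl

  -- Switching the vertices with negative entry replaces y by its absolute value, and the factor c
  -- brings the maximum to 1. It also scales the residual η m, which becomes at most η because m ≤ ∣
  -- y u ∣.
  module Rescaling {n} (Γ : SignedGraph n) (y : Fin n → ℚ) {l η m : ℚ} (0≤η : 0ℚ ≤ η)
                   (u : Fin n) (maximal : ∀ v → ∣ y v ∣ ≤ ∣ y u ∣) (m≤∣yu∣ : m ≤ ∣ y u ∣)
                   (c : ℚ) (0≤c : 0ℚ ≤ c) (∣yu∣*c≡1 : ∣ y u ∣ * c ≡ 1ℚ)
                   (approx : ∀ v → ∣ ∑ (λ j → weight (sign Γ v j) * y j) - l * y v ∣ ≤ η * m) where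

    p : Fin n → Sign
    p = side (negatives y)

    z : Fin n → ℚ
    z v = ∣ y v ∣ * c

    sum : Fin n → ℚ
    sum v = ∑ (λ j → weight (sign Γ v j) * y j)

    switched-term : ∀ v j →
      weight (switchedSign (negatives y) Γ v j) * z j ≡ (signed (p v) * c) * (weight (sign Γ v j) * y j)
    switched-term v j = trans
      (cong₂ (λ a b → a * (b * c))
        (trans (cong weight (switchedSign≡ (negatives y) Γ v j)) (weight-flank (p v) (sign Γ v j) (p j)))
        (sym (side-negatives y j)))
      (switched-term≡ (signed (p v)) (weight (sign Γ v j)) (signed (p j)) (y j) c (signed*signed (p j)))

    switched-sum : ∀ v →
      ∑ (λ j → weight (switchedSign (negatives y) Γ v j) * z j) ≡ (signed (p v) * c) * sum v
    switched-sum v = trans (∑-cong (switched-term v)) (∑-*ˡ (signed (p v) * c) (λ j → weight (sign Γ v j) * y j))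

    residual : ∀ v → - (signed (p v) * (sum v - l * y v)) ≤ η * ∣ y u ∣
    residual v = ℚ.≤-trans (-signed*p≤∣p∣ (p v) (sum v - l * y v))
      (ℚ.≤-trans (approx v) (ℚ.*-monoˡ-≤-nonNeg η {{nonNegative 0≤η}} m≤∣yu∣))

    row : ∀ v → l * z v ≤ ∑ (λ j → weight (switchedSign (negatives y) Γ v j) * z j) + η
    row v = subst₂ _≤_
      (trans (sym (split-residual l (signed (p v)) (y v) c (sum v)))
             (cong (λ a → l * (a * c)) (side-negatives y v)))
      (cong₂ _+_ (sym (switched-sum v))
        (trans (ℚ.*-assoc η ∣ y u ∣ c) (trans (cong (η *_) ∣yu∣*c≡1) (ℚ.*-identityʳ η))))
      (ℚ.+-monoʳ-≤ ((signed (p v) * c) * sum v)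
        (ℚ.*-monoʳ-≤-nonNeg c {{nonNegative 0≤c}} (residual v)))

    rescaled : ApproximateEigenvector (switch (negatives y) Γ) l η
    rescaled = record
      { z    = z
      ; 0≤z  = λ v → 0≤* (ℚ.0≤∣p∣ (y v)) 0≤c
      ; z≤1  = λ v → subst (z v ≤_) ∣yu∣*c≡1 (ℚ.*-monoʳ-≤-nonNeg c {{nonNegative 0≤c}} (maximal v))
      ; u    = u
      ; zu≡1 = ∣yu∣*c≡1
      ; row  = row
      }

  rescale : ∀ {n} (Γ : SignedGraph n) (y : Fin n → ℚ) {l η m} → 0ℚ ≤ η → 0ℚ < m →
    (∃[ i ] m ≤ ∣ y i ∣) →
    (∀ v → ∣ ∑ (λ j → weight (sign Γ v j) * y j) - l * y v ∣ ≤ η * m) →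
    ApproximateEigenvector (switch (negatives y) Γ) l η
  rescale Γ y 0≤η 0<m (i , m≤∣yi∣) approx =
    let u , maximal = maximum i (λ v → ∣ y v ∣)
        m≤∣yu∣ = ℚ.≤-trans m≤∣yi∣ (maximal i)
        c , 0<c , ∣yu∣*c≡1 = inverse (ℚ.<-≤-trans 0<m m≤∣yu∣)
    in Rescaling.rescaled Γ y 0≤η u maximal m≤∣yu∣ c (ℚ.<⇒≤ 0<c) ∣yu∣*c≡1 approx

  -- The lower bound m for a coordinate is known before the index N, so the residual can be demanded
  -- below η m. The switching set and l depend on N, which is why `refute` ranges over all of them.
  approximate : ∀ {n} (Γ : SignedGraph n) (μ : ℝ) → IsEigenvalue (adjacencyMatrix Γ) μ →
    ∀ {L η} → 0ℚ < η → Eventually (λ k → L ≤ seq μ k) →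
    (∀ U l → L ≤ l → ApproximateEigenvector (switch U Γ) l η → ⊥) → ⊥
  approximate Γ μ (x , x≉0 , Ax≈μx) {L} {η} 0<η L≤μ refute = apart x x≉0 λ i m 0<m away →
    let N , late = eventually-both L≤μ (eventually-both away
                     (eventually-all λ v → Ax≈μx v (η * m) (0<* 0<η 0<m)))
        L≤l , m≤xi , close = late N ℕ.≤-refl
        y = λ v → seq (x v) N
    in refute (negatives y) (seq μ N) L≤l (rescale Γ y (ℚ.<⇒≤ 0<η) 0<m (i , m≤xi) λ v →
         subst (λ s → ∣ s - seq μ N * y v ∣ ≤ η * m) (seq-adjacency*ᵥ Γ x v N) (ℚ.<⇒≤ (close v)))

open Approximation

-- Real roots by bisection.

module RootFinding where

  open import Data.Rational
  open +-*-Solver using (solve; con; _:+_; _:*_; _:-_; :-_; _:=_)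

  halves : ℕ → ℚ
  halves zero    = 1ℚ
  halves (suc k) = ½ * halves k

  0<halves : ∀ k → 0ℚ < halves k
  0<halves zero    = ℚ.positive⁻¹ 1ℚ
  0<halves (suc k) = 0<* (ℚ.positive⁻¹ ½) (0<halves k)

  -- This is k < 2^k, from the inductive bound 1 + k ≤ 2^k.
  halves*nat<1 : ∀ k → halves k * nat k < 1ℚ
  halves*nat<1 k = ungap< (subst (0ℚ <_)
    (solve 2 (λ h n → (con 1ℚ :- h :* (con 1ℚ :+ n)) :+ h := con 1ℚ :- h :* n) refl (halves k) (nat k))
    (ℚ.+-mono-≤-< (gap (halves*suc≤1 k)) (0<halves k)))
    where
    halves*suc≤1 : ∀ k → halves k * (1ℚ + nat k) ≤ 1ℚ
    halves*suc≤1 zero    = ℚ.≤-refl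
    halves*suc≤1 (suc k) = ungap (subst (0ℚ ≤_)
      (solve 2 (λ h n → (con 1ℚ :- h :* (con 1ℚ :+ n)) :+ con ½ :* h :* n :=
                        con 1ℚ :- con ½ :* h :* (con 1ℚ :+ (con 1ℚ :+ n))) refl (halves k) (nat k))
      (0≤+ (gap (halves*suc≤1 k)) (0≤* (ℚ.<⇒≤ (0<halves (suc k))) (0≤nat k))))

  halves-small : ∀ C {ε} → 0ℚ < ε → ∃[ N ] halves N * C < ε
  halves-small C {ε} 0<ε =
    let c , _ , ε*c≡1 = inverse 0<ε
        N , C*c≤N = archimedean (C * c)
    in N , (begin-strict
      halves N * C                ≡⟨ cong (halves N *_) (trans (sym (ℚ.*-identityʳ C)) (cong (C *_) (sym ε*c≡1))) ⟩
      halves N * (C * (ε * c))    ≡⟨ solve 4 (λ h C e c → h :* (C :* (e :* c)) := h :* (C :* c) :* e) refl (halves N) C ε c ⟩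
      halves N * (C * c) * ε      ≤⟨ ℚ.*-monoʳ-≤-nonNeg ε {{nonNegative (ℚ.<⇒≤ 0<ε)}}
                                       (ℚ.*-monoˡ-≤-nonNeg (halves N) {{nonNegative (ℚ.<⇒≤ (0<halves N))}} C*c≤N) ⟩
      halves N * nat N * ε        <⟨ ℚ.*-monoˡ-<-pos ε {{positive 0<ε}} (halves*nat<1 N) ⟩
      1ℚ * ε                      ≡⟨ ℚ.*-identityˡ ε ⟩
      ε                           ∎)
    where open ℚ.≤-Reasoning

  module Bisection (f : ℚ → ℚ) (a₀ b₀ : ℚ) (a₀≤b₀ : a₀ ≤ b₀) (fa₀≤0 : f a₀ ≤ 0ℚ) (0≤fb₀ : 0ℚ ≤ f b₀) where

    record Bracket (w : ℚ) : Set where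
      field
        lo hi : ℚ
        width : hi - lo ≡ w
        f-lo  : f lo ≤ 0ℚ
        f-hi  : 0ℚ ≤ f hi

    open Bracket

    halve : ∀ {w} → Bracket w → Bracket (½ * w)
    halve {w} B with ℚ.≤-total (f (½ * (lo B + hi B))) 0ℚ
    ... | inj₁ f≤0 = record
      { lo    = ½ * (lo B + hi B)
      ; hi    = hi B
      ; width = trans (solve 2 (λ a b → b :- con ½ :* (a :+ b) := con ½ :* (b :- a)) refl (lo B) (hi B))
                      (cong (½ *_) (width B))
      ; f-lo  = f≤0
      ; f-hi  = f-hi B
      }
    ... | inj₂ 0≤f = record
      { lo    = lo B
      ; hi    = ½ * (lo B + hi B)
      ; width = trans (solve 2 (λ a b → con ½ :* (a :+ b) :- a := con ½ :* (b :- a)) refl (lo B) (hi B))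
                      (cong (½ *_) (width B))
      ; f-lo  = f-lo B
      ; f-hi  = 0≤f
      }

    scale : ℕ → ℚ
    scale k = halves k * (b₀ - a₀)

    0≤scale : ∀ k → 0ℚ ≤ scale k
    0≤scale k = 0≤* (ℚ.<⇒≤ (0<halves k)) (gap a₀≤b₀)

    lo≤hi : ∀ {w} → 0ℚ ≤ w → (B : Bracket w) → lo B ≤ hi B
    lo≤hi 0≤w B = ungap (subst (0ℚ ≤_) (sym (width B)) 0≤w)

    halve-nested : ∀ {w} → 0ℚ ≤ w → (B : Bracket w) → lo B ≤ lo (halve B) × hi (halve B) ≤ hi B
    halve-nested {w} 0≤w B with ℚ.≤-total (f (½ * (lo B + hi B))) 0ℚ
    ... | inj₁ _ = ungap (subst (0ℚ ≤_)
      (trans (cong (½ *_) (sym (width B)))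
        (solve 2 (λ a b → con ½ :* (b :- a) := con ½ :* (a :+ b) :- a) refl (lo B) (hi B)))
      (0≤* (ℚ.nonNegative⁻¹ ½) 0≤w)) , ℚ.≤-refl
    ... | inj₂ _ = ℚ.≤-refl , ungap (subst (0ℚ ≤_)
      (trans (cong (½ *_) (sym (width B)))
        (solve 2 (λ a b → con ½ :* (b :- a) := b :- con ½ :* (a :+ b)) refl (lo B) (hi B)))
      (0≤* (ℚ.nonNegative⁻¹ ½) 0≤w))

    bracket : ∀ k → Bracket (scale k)
    bracket zero    = record
      { lo = a₀ ; hi = b₀ ; width = sym (ℚ.*-identityˡ (b₀ - a₀)) ; f-lo = fa₀≤0 ; f-hi = 0≤fb₀ }
    -- The type records the width, and `halve` associates the factor ½ differently; `step` has to
    -- see through this `subst`.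
    bracket (suc k) = subst Bracket (sym (ℚ.*-assoc ½ (halves k) (b₀ - a₀))) (halve (bracket k))

    low high : ℕ → ℚ
    low  k = lo (bracket k)
    high k = hi (bracket k)

    low≤high : ∀ k → low k ≤ high k
    low≤high k = lo≤hi (0≤scale k) (bracket k)

    step : ∀ k → low k ≤ low (suc k) × high (suc k) ≤ high k
    step k = transport (ℚ.*-assoc ½ (halves k) (b₀ - a₀)) (halve-nested (0≤scale k) (bracket k))
      where
      transport : ∀ {w w′} (w≡ : w′ ≡ w) {B : Bracket w} →
        low k ≤ lo B × hi B ≤ high k →
        low k ≤ lo (subst Bracket (sym w≡) B) × hi (subst Bracket (sym w≡) B) ≤ high k
      transport refl nested = nested

    nested : ∀ {N k} → N ℕ.≤ k → low N ≤ low k × high k ≤ high N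
    nested {N} {k} N≤k = nested′ (ℕ.≤⇒≤′ N≤k)
      where
      nested′ : ∀ {k} → N ℕ.≤′ k → low N ≤ low k × high k ≤ high N
      nested′ ℕ.≤′-refl = ℚ.≤-refl , ℚ.≤-refl
      nested′ {suc k} (ℕ.≤′-step N≤k) =
        ℚ.≤-trans (proj₁ (nested′ N≤k)) (proj₁ (step k)) ,
        ℚ.≤-trans (proj₂ (step k)) (proj₂ (nested′ N≤k))

    width-small : ∀ C {ε} → 0ℚ ≤ C → 0ℚ < ε → ∃[ N ] ∀ k → N ℕ.≤ k → C * (high k - low k) < ε
    width-small C {ε} 0≤C 0<ε =
      let N , small = halves-small ((b₀ - a₀) * C) 0<ε
      in N , λ k N≤k → ℚ.≤-<-trans
        (ℚ.*-monoˡ-≤-nonNeg C {{nonNegative 0≤C}}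
          (ℚ.+-mono-≤ (proj₂ (nested N≤k)) (ℚ.neg-antimono-≤ (proj₁ (nested N≤k)))))
        (subst (_< ε)
          (trans (solve 3 (λ h d C → h :* (d :* C) := C :* (h :* d)) refl (halves N) (b₀ - a₀) C)
                 (cong (C *_) (sym (width (bracket N)))))
          small)

    -- From N on both ends of a bracket stay inside the N-th one, so its width controls the lower
    -- ends.
    root : ℝ
    root = mkℝ low λ ε 0<ε →
      let N , small = width-small 1ℚ 0≤1 0<ε
      in N , λ m n N≤m N≤n → ℚ.≤-<-trans
        (∣p-q∣≤ (proj₁ (nested N≤m)) (ℚ.≤-trans (low≤high m) (proj₂ (nested N≤m)))
                (proj₁ (nested N≤n)) (ℚ.≤-trans (low≤high n) (proj₂ (nested N≤n))))
        (subst (_< ε) (ℚ.*-identityˡ (high N - low N)) (small N ℕ.≤-refl))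

    a₀≤low : ∀ k → a₀ ≤ low k
    a₀≤low k = proj₁ (nested {0} {k} z≤n)

    high≤b₀ : ∀ k → high k ≤ b₀
    high≤b₀ k = proj₂ (nested {0} {k} z≤n)

    -- As f is nonpositive at the lower end and nonnegative at the upper one, ∣ f (low k) ∣ is at
    -- most the increase of f over the bracket.
    residual-small : ∀ C → 0ℚ ≤ C →
      (∀ {a b} → a₀ ≤ a → a ≤ b → b ≤ b₀ → f b - f a ≤ C * (b - a)) →
      ∀ {ε} → 0ℚ < ε → ∃[ N ] ∀ k → N ℕ.≤ k → ∣ f (low k) ∣ < ε
    residual-small C 0≤C lipschitz 0<ε =
      let N , small = width-small C 0≤C 0<ε
      in N , λ k N≤k → ℚ.≤-<-trans (begin
        ∣ f (low k) ∣             ≡⟨ ℚ.∣-p∣≡∣p∣ (f (low k)) ⟨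
        ∣ - f (low k) ∣           ≡⟨ ℚ.0≤p⇒∣p∣≡p (ℚ.neg-antimono-≤ (f-lo (bracket k))) ⟩
        - f (low k)               ≡⟨ ℚ.+-identityˡ (- f (low k)) ⟨
        0ℚ - f (low k)            ≤⟨ ℚ.+-monoˡ-≤ (- f (low k)) (f-hi (bracket k)) ⟩
        f (high k) - f (low k)    ≤⟨ lipschitz (a₀≤low k) (low≤high k) (high≤b₀ k) ⟩
        C * (high k - low k)      ∎) (small k N≤k)
      where open ℚ.≤-Reasoning

open RootFinding

-- An eigenvalue of Γ₁ and its lower bound.

module IndexOfΓ₁ where

  open import Data.Rational
  open +-*-Solver using (solve; con; _:+_; _:*_; _:-_; :-_; _:=_)

  approximate⇒eigenvector : ∀ {n} (Γ : SignedGraph n) (μ : ℝ) (x : Fin n → ℝ) (y : ℕ → Fin n → ℚ) →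
    (∀ j k → seq (x j) k ≡ y k j) →
    (∀ v ε → 0ℚ < ε → Eventually (λ k → ∣ ∑ (λ j → weight (sign Γ v j) * y k j) - seq μ k * y k v ∣ < ε)) →
    ∀ v → (adjacencyMatrix Γ *ᵥ x) v ≈ μ Defs.* x v
  approximate⇒eigenvector Γ μ x y x≡y small v ε 0<ε =
    proj₁ (small v ε 0<ε) , λ k N≤k → ℚ.≤-<-trans
      (ℚ.≤-reflexive (cong₂ (λ s t → ∣ s - t ∣)
        (seq-sum (λ j → adjacencyMatrix Γ v j Defs.* x j) (λ j → weight (sign Γ v j) * y k j) k
          (λ j → cong₂ _*_ (seq-entry (sign Γ v j) k) (x≡y j k)))
        (cong (seq μ k *_) (x≡y v k))))
      (proj₂ (small v ε 0<ε) k N≤k)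

  1≤⇒≉0 : ∀ x → (∀ k → 1ℚ ≤ seq x k) → ¬ x ≈ 0ℝ
  1≤⇒≉0 x 1≤x x≈0 with x≈0 1ℚ (ℚ.positive⁻¹ 1ℚ)
  ... | N , small = ℚ.<-irrefl refl (ℚ.≤-<-trans (1≤x N) (subst (_< 1ℚ)
    (trans (cong ∣_∣ (ℚ.+-identityʳ (seq x N))) (ℚ.0≤p⇒∣p∣≡p (ℚ.≤-trans 0≤1 (1≤x N)))) (small N ℕ.≤-refl)))

  ∑-others : ∀ {n} (i : Fin n) c →
    ∑ {n} (λ j → weight (if toℕ i ℕ.≡ᵇ toℕ j then nothing else just Sign.+) * c) + c ≡ nat n * c
  ∑-others {suc n} zero c = begin
    0ℚ * c + S + c             ≡⟨ cong (λ s → 0ℚ * c + s + c) {x = S} (∑-const n (1ℚ * c)) ⟩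
    0ℚ * c + nat n * (1ℚ * c) + c
      ≡⟨ solve 2 (λ c k → con 0ℚ :* c :+ k :* (con 1ℚ :* c) :+ c := (con 1ℚ :+ k) :* c) refl c (nat n) ⟩
    (1ℚ + nat n) * c           ∎
    where
    open ≡-Reasoning
    S = ∑ {n} (λ _ → 1ℚ * c)
  ∑-others {suc n} (suc i) c = begin
    1ℚ * c + S + c             ≡⟨ ℚ.+-assoc (1ℚ * c) S c ⟩
    1ℚ * c + (S + c)           ≡⟨ cong (_+_ (1ℚ * c)) {x = S + c} (∑-others i c) ⟩
    1ℚ * c + nat n * c
      ≡⟨ solve 2 (λ c k → con 1ℚ :* c :+ k :* c := (con 1ℚ :+ k) :* c) refl c (nat n) ⟩
    (1ℚ + nat n) * c           ∎
    where
    open ≡-Reasoning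
    S = ∑ {n} (λ j → weight (if toℕ i ℕ.≡ᵇ toℕ j then nothing else just Sign.+) * c)

  row₀ : ∀ l p v {S} → S ≡ v * (0ℚ * (l + 1ℚ)) →
    0ℚ * p + (- 1ℚ * p + (1ℚ * ((l + 1ℚ) * p) + S)) - l * p ≡ 0ℚ
  row₀ l p v refl = solve 3 (λ l p v →
    con 0ℚ :* p :+ (con (- 1ℚ) :* p :+ (con 1ℚ :* ((l :+ con 1ℚ) :* p) :+ v :* (con 0ℚ :* (l :+ con 1ℚ)))) :- l :* p
    := con 0ℚ) refl l p v

  row₁ : ∀ l p v {S} → S ≡ v * (0ℚ * (l + 1ℚ)) →
    - 1ℚ * p + (0ℚ * p + (1ℚ * ((l + 1ℚ) * p) + S)) - l * p ≡ 0ℚ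
  row₁ l p v refl = solve 3 (λ l p v →
    con (- 1ℚ) :* p :+ (con 0ℚ :* p :+ (con 1ℚ :* ((l :+ con 1ℚ) :* p) :+ v :* (con 0ℚ :* (l :+ con 1ℚ)))) :- l :* p
    := con 0ℚ) refl l p v

  row₂ : ∀ l v {S} → let p = l + (1ℚ - v) in S ≡ v * (1ℚ * (l + 1ℚ)) →
    1ℚ * p + (1ℚ * p + (0ℚ * ((l + 1ℚ) * p) + S)) - l * ((l + 1ℚ) * p) ≡
    - ((l - v) * ((l + 1ℚ) * (l + 1ℚ) - 2ℚ) - 2ℚ)
  row₂ l v refl = solve 2 (λ l v → let p = l :+ (con 1ℚ :- v) in
    con 1ℚ :* p :+ (con 1ℚ :* p :+ (con 0ℚ :* ((l :+ con 1ℚ) :* p) :+ v :* (con 1ℚ :* (l :+ con 1ℚ)))) :-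
      l :* ((l :+ con 1ℚ) :* p)
    := :- ((l :- v) :* ((l :+ con 1ℚ) :* (l :+ con 1ℚ) :- con 2ℚ) :- con 2ℚ)) refl l v

  row₃ : ∀ l v S → let p = l + (1ℚ - v) in S + (l + 1ℚ) ≡ v * (l + 1ℚ) →
    0ℚ * p + (0ℚ * p + (1ℚ * ((l + 1ℚ) * p) + S)) - l * (l + 1ℚ) ≡ 0ℚ
  row₃ l v S eq = trans
    (solve 3 (λ l v S → let p = l :+ (con 1ℚ :- v) in
      con 0ℚ :* p :+ (con 0ℚ :* p :+ (con 1ℚ :* ((l :+ con 1ℚ) :* p) :+ S)) :- l :* (l :+ con 1ℚ)
      := (S :+ (l :+ con 1ℚ)) :- v :* (l :+ con 1ℚ)) refl l v S)
    (trans (cong (_- v * (l + 1ℚ)) eq) (ℚ.+-inverseʳ (v * (l + 1ℚ))))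

  reciprocal≤1/3 : ∀ {v i} → 2ℚ ≤ v → 0ℚ ≤ i → (1ℚ + v) * i ≡ 1ℚ → i ≤ + 1 / 3
  reciprocal≤1/3 {v} {i} 2≤v 0≤i m*i≡1 = ungap (subst (0ℚ ≤_) (trans
    (solve 2 (λ v i → con (+ 1 / 3) :* ((v :- con 2ℚ) :* i) :=
      con (+ 1 / 3) :* ((con 1ℚ :+ v) :* i) :- i) refl v i)
    (cong (λ e → + 1 / 3 * e - i) m*i≡1))
    (0≤* (ℚ.nonNegative⁻¹ (+ 1 / 3)) (0≤* (gap 2≤v) 0≤i)))

  -- The order is written 3 + r here, so that ν = nat r is again n - 3, and i is 1/(n - 2).
  module Γ₁-Eigenvalue (r : ℕ) (2≤ν : 2ℚ ≤ nat r) (i : ℚ) (0≤i : 0ℚ ≤ i) (m*i≡1 : (1ℚ + nat r) * i ≡ 1ℚ) where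

    private
      ν = nat r

    0≤ν : 0ℚ ≤ ν
    0≤ν = 0≤nat r

    f : ℚ → ℚ
    f l = (l - ν) * ((l + 1ℚ) * (l + 1ℚ) - 2ℚ) - 2ℚ

    i≤1/3 : i ≤ + 1 / 3
    i≤1/3 = reciprocal≤1/3 2≤ν 0≤i m*i≡1

    -- For λ near ν the factor (λ + 1)² - 2 is roughly (ν + 1)², which puts the root near ν + 2 i².
    a₀ b₀ : ℚ
    a₀ = ν + 2ℚ * (i * i)
    b₀ = ν + 1ℚ

    0≤i² : 0ℚ ≤ i * i
    0≤i² = 0≤* 0≤i 0≤i

    i²≤1/9 : 0ℚ ≤ + 1 / 9 - i * i
    i²≤1/9 = subst (0ℚ ≤_)
      (solve 1 (λ i → (con (+ 1 / 3) :- i) :* (con (+ 1 / 3) :+ i) := con (+ 1 / 9) :- i :* i) refl i)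
      (0≤* (gap i≤1/3) (0≤+ (ℚ.nonNegative⁻¹ (+ 1 / 3)) 0≤i))

    a₀≤b₀ : a₀ ≤ b₀
    a₀≤b₀ = ungap (subst (0ℚ ≤_)
      (solve 2 (λ v i → con 2ℚ :* (con (+ 1 / 9) :- i :* i) :+ con (+ 7 / 9) :=
                        v :+ con 1ℚ :- (v :+ con 2ℚ :* (i :* i))) refl ν i)
      (0≤+ (0≤* (ℚ.nonNegative⁻¹ 2ℚ) i²≤1/9) (ℚ.nonNegative⁻¹ (+ 7 / 9))))

    -- As (ν + 1) i = 1, f a₀ = - 4 i² (1 - 2 i - 2 i⁴).
    f-a₀ : f a₀ ≤ 0ℚ
    f-a₀ = ungap (subst (0ℚ ≤_) (trans
      (solve 1 (λ i →
        con (+ 4 / 1) :* (i :* i) :*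
          (con 2ℚ :* (con (+ 1 / 3) :- i) :+
           con 2ℚ :* ((con (+ 1 / 9) :- i :* i) :* (con (+ 1 / 9) :+ i :* i)) :+ con (+ 25 / 81))
        := con 0ℚ :- (con 2ℚ :* (con 1ℚ :* con 1ℚ) :- con 2ℚ :+
             (con (+ 8 / 1) :* (i :* i :* i) :* con 1ℚ :+
              (con (+ 8 / 1) :* (i :* i :* i :* i :* i :* i) :- con (+ 4 / 1) :* (i :* i)))))
        refl i)
      (trans (cong (λ e → 0ℚ - (2ℚ * (e * e) - 2ℚ + ((+ 8 / 1) * (i * i * i) * e +
                           ((+ 8 / 1) * (i * i * i * i * i * i) - (+ 4 / 1) * (i * i))))) (sym m*i≡1))
        (solve 2 (λ v i →
          con 0ℚ :- (con 2ℚ :* (((con 1ℚ :+ v) :* i) :* ((con 1ℚ :+ v) :* i)) :- con 2ℚ :+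
             (con (+ 8 / 1) :* (i :* i :* i) :* ((con 1ℚ :+ v) :* i) :+
              (con (+ 8 / 1) :* (i :* i :* i :* i :* i :* i) :- con (+ 4 / 1) :* (i :* i))))
          := con 0ℚ :- ((v :+ con 2ℚ :* (i :* i) :- v) :*
               ((v :+ con 2ℚ :* (i :* i) :+ con 1ℚ) :* (v :+ con 2ℚ :* (i :* i) :+ con 1ℚ) :- con 2ℚ) :- con 2ℚ))
          refl ν i)))
      (0≤* (0≤* (ℚ.nonNegative⁻¹ (+ 4 / 1)) 0≤i²)
        (0≤+ (0≤+ (0≤* (ℚ.nonNegative⁻¹ 2ℚ) (gap i≤1/3))
                  (0≤* (ℚ.nonNegative⁻¹ 2ℚ) (0≤* i²≤1/9 (0≤+ (ℚ.nonNegative⁻¹ (+ 1 / 9)) 0≤i²))))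
             (ℚ.nonNegative⁻¹ (+ 25 / 81)))))

    f-b₀ : 0ℚ ≤ f b₀
    f-b₀ = subst (0ℚ ≤_)
      (solve 1 (λ v → v :* v :+ con (+ 4 / 1) :* v :=
        (v :+ con 1ℚ :- v) :* ((v :+ con 1ℚ :+ con 1ℚ) :* (v :+ con 1ℚ :+ con 1ℚ) :- con 2ℚ) :- con 2ℚ) refl ν)
      (0≤+ (0≤* 0≤ν 0≤ν) (0≤* (ℚ.nonNegative⁻¹ (+ 4 / 1)) 0≤ν))

    open Bisection f a₀ b₀ a₀≤b₀ f-a₀ f-b₀ public

    0≤a₀ : 0ℚ ≤ a₀
    0≤a₀ = 0≤+ 0≤ν (0≤* (ℚ.nonNegative⁻¹ 2ℚ) 0≤i²)

    -- Bounds the derivative 3l² + 4l - 2νl - 2ν - 1 of f for 0 ≤ l ≤ b₀, its negative terms being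
    -- dropped.
    C : ℚ
    C = 3ℚ * (b₀ * b₀) + (+ 4 / 1) * b₀

    0≤b₀ : 0ℚ ≤ b₀
    0≤b₀ = 0≤+ 0≤ν 0≤1

    0≤C : 0ℚ ≤ C
    0≤C = 0≤+ (0≤* (ℚ.nonNegative⁻¹ 3ℚ) (0≤* 0≤b₀ 0≤b₀)) (0≤* (ℚ.nonNegative⁻¹ (+ 4 / 1)) 0≤b₀)

    f-lipschitz : ∀ {a b} → a₀ ≤ a → a ≤ b → b ≤ b₀ → f b - f a ≤ C * (b - a)
    f-lipschitz {a} {b} a₀≤a a≤b b≤b₀ = ungap (subst (0ℚ ≤_)
      (solve 4 (λ v a b B →
        (b :- a) :* (((B :* (B :- a) :+ a :* (B :- a)) :+ (B :* (B :- b) :+ b :* (B :- b)) :+ (B :* (B :- a) :+ a :* (B :- b))) :+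
          (con 2ℚ :* (B :- a) :+ con 2ℚ :* (B :- b)) :+ v :* (a :+ b) :+ (con 1ℚ :+ con 2ℚ :* v))
        := (con 3ℚ :* (B :* B) :+ con (+ 4 / 1) :* B) :* (b :- a) :-
           (((b :- v) :* ((b :+ con 1ℚ) :* (b :+ con 1ℚ) :- con 2ℚ) :- con 2ℚ) :-
            ((a :- v) :* ((a :+ con 1ℚ) :* (a :+ con 1ℚ) :- con 2ℚ) :- con 2ℚ)))
        refl ν a b b₀)
      (0≤* (gap a≤b)
        (0≤+ (0≤+ (0≤+ (0≤+ (0≤+ (0≤+ (0≤* 0≤b₀ b₀-a) (0≤* 0≤a b₀-a)) (0≤+ (0≤* 0≤b₀ b₀-b) (0≤* 0≤b b₀-b)))
                            (0≤+ (0≤* 0≤b₀ b₀-a) (0≤* 0≤a b₀-b)))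
                       (0≤+ (0≤* 0≤2 b₀-a) (0≤* 0≤2 b₀-b)))
                  (0≤* 0≤ν (0≤+ 0≤a 0≤b)))
             (0≤+ 0≤1 (0≤* 0≤2 0≤ν)))))
      where
      0≤2 : 0ℚ ≤ 2ℚ
      0≤2 = ℚ.nonNegative⁻¹ 2ℚ
      0≤a : 0ℚ ≤ a
      0≤a = ℚ.≤-trans 0≤a₀ a₀≤a
      0≤b : 0ℚ ≤ b
      0≤b = ℚ.≤-trans 0≤a a≤b
      b₀-a : 0ℚ ≤ b₀ - a
      b₀-a = gap (ℚ.≤-trans a≤b b≤b₀)
      b₀-b : 0ℚ ≤ b₀ - b
      b₀-b = gap b≤b₀

    -- The rows of every vertex but v₃ hold identically, and the row of v₃ is f λ = 0.
    vec : Fin (3 ℕ.+ r) → ℝ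
    vec zero                = root Defs.+ fromℚ (1ℚ - ν)
    vec (suc zero)          = root Defs.+ fromℚ (1ℚ - ν)
    vec (suc (suc zero))    = (root Defs.+ 1ℝ) Defs.* (root Defs.+ fromℚ (1ℚ - ν))
    vec (suc (suc (suc j))) = root Defs.+ 1ℝ

    -- With x₁ = x₂ and equal entries x₄ = ... = xₙ, the rows of v₁ and v₄ read x₃ = (l + 1) x₁ and
    -- x₃ = (l + 1 - ν) x₄; this is their common solution.
    value : ℚ → Fin (3 ℕ.+ r) → ℚ
    value l zero                = l + (1ℚ - ν)
    value l (suc zero)          = l + (1ℚ - ν)
    value l (suc (suc zero))    = (l + 1ℚ) * (l + (1ℚ - ν))
    value l (suc (suc (suc j))) = l + 1ℚ

    seq-vec : ∀ j k → seq (vec j) k ≡ value (low k) j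
    seq-vec zero                k = refl
    seq-vec (suc zero)          k = refl
    seq-vec (suc (suc zero))    k = refl
    seq-vec (suc (suc (suc j))) k = refl

    product-row : ℚ → Fin (3 ℕ.+ r) → ℚ
    product-row l v = ∑ (λ j → weight (sign (Γ₁ (3 ℕ.+ r)) v j) * value l j)

    residual≡ : ∀ l v → product-row l v - l * value l v ≡ 0ℚ ⊎ product-row l v - l * value l v ≡ - f l
    residual≡ l zero                = inj₁ (row₀ l (l + (1ℚ - ν)) ν (∑-const r (0ℚ * (l + 1ℚ))))
    residual≡ l (suc zero)          = inj₁ (row₁ l (l + (1ℚ - ν)) ν (∑-const r (0ℚ * (l + 1ℚ))))
    residual≡ l (suc (suc zero))    = inj₂ (row₂ l ν (∑-const r (1ℚ * (l + 1ℚ))))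
    residual≡ l (suc (suc (suc j))) = inj₁ (row₃ l ν
      (∑ {r} (λ k → weight (if toℕ j ℕ.≡ᵇ toℕ k then nothing else just Sign.+) * (l + 1ℚ)))
      (∑-others j (l + 1ℚ)))

    residual-≤ : ∀ l v → ∣ product-row l v - l * value l v ∣ ≤ ∣ f l ∣
    residual-≤ l v with residual≡ l v
    ... | inj₁ ≡0  = subst (_≤ ∣ f l ∣) (sym (cong ∣_∣ ≡0)) (ℚ.0≤∣p∣ (f l))
    ... | inj₂ ≡-f = ℚ.≤-reflexive (trans (cong ∣_∣ ≡-f) (ℚ.∣-p∣≡∣p∣ (f l)))

    -- All approximations of the root are at least ν, so the coordinate at v₁ stays at least 1.
    vec≉0 : ¬ (∀ j → vec j ≈ 0ℝ)
    vec≉0 vec≈0 = 1≤⇒≉0 (vec zero) (λ k → 1≤value (ν≤low k)) (vec≈0 zero)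
      where
      ν≤low : ∀ k → ν ≤ low k
      ν≤low k = ℚ.≤-trans (subst (_≤ a₀) (ℚ.+-identityʳ ν)
        (ℚ.+-monoʳ-≤ ν (0≤* (ℚ.nonNegative⁻¹ 2ℚ) 0≤i²))) (a₀≤low k)
      1≤value : ∀ {l} → ν ≤ l → 1ℚ ≤ l + (1ℚ - ν)
      1≤value {l} ν≤l = ungap (subst (0ℚ ≤_)
        (solve 2 (λ l v → l :- v := l :+ (con 1ℚ :- v) :- con 1ℚ) refl l ν) (gap ν≤l))

    root-eigenvalue : IsEigenvalue (adjacencyMatrix (Γ₁ (3 ℕ.+ r))) root
    root-eigenvalue = vec , vec≉0 ,
      approximate⇒eigenvector (Γ₁ (3 ℕ.+ r)) root vec (λ k → value (low k)) seq-vec λ v ε 0<ε →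
        let N , small = residual-small C 0≤C f-lipschitz 0<ε
        in N , λ k N≤k → ℚ.≤-<-trans (residual-≤ (low k) v) (small k N≤k)

    root≤index : ∀ ρ → IsIndex (Γ₁ (3 ℕ.+ r)) ρ → root Defs.≤ ρ
    root≤index ρ (_ , largest) = largest root root-eigenvalue

open IndexOfΓ₁

-- Choice of the tolerance and assembly.

module Conclusion where

  open import Data.Rational
  open +-*-Solver using (solve; con; _:+_; _:*_; _:-_; :-_; _:=_)

  -- Of the margin 2 i², 2η is lost in comparing reals and another 2η is demanded by `Estimates`;
  -- with η proportional to i² this fits for every n.
  tolerance : ℚ → ℚ
  tolerance i = i * i * 1/200

  threshold : ℚ → ℚ → ℚ
  threshold ν i = ν + 2ℚ * (i * i) - (tolerance i + tolerance i)

  module Tolerance (ν i : ℚ) (0<i : 0ℚ < i) (i≤1/3 : i ≤ + 1 / 3) where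

    private
      η = tolerance i
      L = threshold ν i

    0≤i² : 0ℚ ≤ i * i
    0≤i² = 0≤* (ℚ.<⇒≤ 0<i) (ℚ.<⇒≤ 0<i)

    0<η : 0ℚ < η
    0<η = 0<* (0<* 0<i 0<i) (ℚ.positive⁻¹ 1/200)

    η≤1/200 : η ≤ 1/200
    η≤1/200 = ungap (subst (0ℚ ≤_)
      (solve 1 (λ i →
        con 1/200 :* ((con (+ 1 / 3) :- i) :* (con (+ 1 / 3) :+ i) :+ con (+ 8 / 9)) :=
        con 1/200 :- i :* i :* con 1/200) refl i)
      (0≤* (ℚ.nonNegative⁻¹ 1/200)
        (0≤+ (0≤* (gap i≤1/3) (0≤+ (ℚ.nonNegative⁻¹ (+ 1 / 3)) (ℚ.<⇒≤ 0<i))) (ℚ.nonNegative⁻¹ (+ 8 / 9)))))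

    ν+2η≤L : ν + (η + η) ≤ L
    ν+2η≤L = ungap (subst (0ℚ ≤_)
      (solve 2 (λ v s → con (+ 99 / 50) :* s :=
        v :+ con 2ℚ :* s :- (s :* con 1/200 :+ s :* con 1/200) :- (v :+ (s :* con 1/200 :+ s :* con 1/200)))
        refl ν (i * i))
      (0≤* (ℚ.nonNegative⁻¹ (+ 99 / 50)) 0≤i²))

    3≤ν⇒11/5≤L : 3ℚ ≤ ν → 11/5 ≤ L
    3≤ν⇒11/5≤L 3≤ν = ungap (subst (0ℚ ≤_)
      (solve 2 (λ v s → (v :- con 3ℚ) :+ (con (+ 199 / 100) :* s :+ con (+ 4 / 5)) :=
        v :+ con 2ℚ :* s :- (s :* con 1/200 :+ s :* con 1/200) :- con 11/5) refl ν (i * i))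
      (0≤+ (gap 3≤ν) (0≤+ (0≤* (ℚ.nonNegative⁻¹ (+ 199 / 100)) 0≤i²) (ℚ.nonNegative⁻¹ (+ 4 / 5)))))

    -- For n = 5 the threshold is 2 + 199/900, just above 11/5 = 2 + 180/900.
    ν≡2⇒11/5≤L : ν ≡ 2ℚ → (1ℚ + ν) * i ≡ 1ℚ → 11/5 ≤ L
    ν≡2⇒11/5≤L refl m*i≡1 = ungap (subst (0ℚ ≤_)
      (trans (cong (λ e → + 199 / 900 * (e * e) - + 1 / 5) (sym m*i≡1))
        (solve 1 (λ i → let m*i = (con 1ℚ :+ con 2ℚ) :* i in
          con (+ 199 / 900) :* (m*i :* m*i) :- con (+ 1 / 5) :=
          con 2ℚ :+ con 2ℚ :* (i :* i) :- (i :* i :* con 1/200 :+ i :* i :* con 1/200) :- con 11/5) refl i))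
      (ℚ.nonNegative⁻¹ (+ 19 / 900)))

  -- Each of the two inequalities between reals costs one e.
  eventually-above : ∀ {a e} x y z → 0ℚ < e → (∀ k → a ≤ seq x k) → x Defs.≤ y → y Defs.≤ z →
    Eventually (λ k → a - (e + e) ≤ seq z k)
  eventually-above {a} {e} x y z 0<e a≤x x≤y y≤z =
    let M , x<y+e = x≤y e 0<e
        N , y<z+e = y≤z e 0<e
    in M ℕ.⊔ N , λ k ≤k → ungap (subst (0ℚ ≤_)
      (solve 5 (λ a ρ s t e → (ρ :- a) :+ ((s :+ e :- ρ) :+ (t :+ e :- s)) := t :- (a :- (e :+ e)))
        refl a (seq x k) (seq y k) (seq z k) e)
      (0≤+ (gap (a≤x k)) (0≤+ (gap (ℚ.<⇒≤ (x<y+e k (ℕ.m⊔n≤o⇒m≤o M N ≤k))))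
                              (gap (ℚ.<⇒≤ (y<z+e k (ℕ.m⊔n≤o⇒n≤o M N ≤k)))))))

  lower-bound : ∀ n r → n ≡ 3 ℕ.+ r → 2ℚ ≤ nat r → ∀ i → 0ℚ < i → (1ℚ + nat r) * i ≡ 1ℚ →
    (μ ρ : ℝ) → IsIndex (Γ₁ n) ρ → ρ Defs.≤ μ → Eventually (λ k → threshold (nat r) i ≤ seq μ k)
  lower-bound _ r refl 2≤ν i 0<i m*i≡1 μ ρ index ρ≤μ =
    eventually-above {nat r + 2ℚ * (i * i)} {tolerance i} (Γ₁-Eigenvalue.root r 2≤ν i 0≤i m*i≡1) ρ μ
      (0<* (0<* 0<i 0<i) (ℚ.positive⁻¹ 1/200)) (Γ₁-Eigenvalue.a₀≤low r 2≤ν i 0≤i m*i≡1)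
      (Γ₁-Eigenvalue.root≤index r 2≤ν i 0≤i m*i≡1 ρ index) ρ≤μ
    where
    0≤i : 0ℚ ≤ i
    0≤i = ℚ.<⇒≤ 0<i

  2≤nat : ∀ r → 2ℚ ≤ nat (2 ℕ.+ r)
  2≤nat r = ungap (subst (0ℚ ≤_)
    (solve 1 (λ x → x := con 1ℚ :+ (con 1ℚ :+ x) :- con 2ℚ) refl (nat r)) (0≤nat r))

  -- The hypotheses on Γ carry over to `switch U Γ`, and if that is extremal, U itself witnesses the
  -- excluded equivalence. The order enters through an equation, so that matching on `refl` gives an
  -- arbitrary n the required shape.
  large-index : ∀ n r → n ≡ 5 ℕ.+ r → ∀ i → 0ℚ < i → (1ℚ + nat (2 ℕ.+ r)) * i ≡ 1ℚ →
    (Γ : SignedGraph n) → Unbalanced Γ → ¬ SwitchingEquivalent Γ (Γ₁ n) →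
    (μ : ℝ) → IsEigenvalue (adjacencyMatrix Γ) μ →
    Eventually (λ k → threshold (nat (2 ℕ.+ r)) i ≤ seq μ k) → HasNegativeC₄ Γ
  large-index _ r refl i 0<i m*i≡1 Γ unbalanced ¬equivalent μ eigenvalue L≤μ =
    hasNegativeC₄ Γ λ noC₄ → approximate Γ μ eigenvalue 0<η L≤μ λ U l L≤l E →
      let _ , _ , _ , extremal = Structure.is-extremal r (switch U Γ) (switch-noC₄ U Γ noC₄)
            (λ potential → unbalanced (potential⇒balanced Γ (switch-potential U Γ potential)))
            l (tolerance i) E 0<η η≤1/200 (ℚ.≤-trans ν+2η≤L L≤l) (ℚ.≤-trans 11/5≤L L≤l)
      in ¬equivalent (switch U Γ , Star.return (U , λ _ _ → refl) , extremal⇒≅Γ₁ (switch U Γ) extremal)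
    where
    open Tolerance (nat (2 ℕ.+ r)) i 0<i (reciprocal≤1/3 (2≤nat r) (ℚ.<⇒≤ 0<i) m*i≡1)
    11/5≤L : 11/5 ≤ threshold (nat (2 ℕ.+ r)) i
    11/5≤L = [ 3≤ν⇒11/5≤L , (λ ν≡2 → ν≡2⇒11/5≤L ν≡2 m*i≡1) ]′ (nat≥3⊎nat≡2 r)

  reciprocal : ∀ r → ∃[ i ] 0ℚ < i × (1ℚ + nat r) * i ≡ 1ℚ
  reciprocal r = inverse (ℚ.+-mono-<-≤ (ℚ.positive⁻¹ 1ℚ) (0≤nat r))

open Conclusion
open Defs using (_≤_)

theorem1 : (n : ℕ) → 5 ℕ.≤ n →
    (Γ : SignedGraph n) → Unbalanced Γ →
    (λ₁Γ λ₁Γ₁ : ℝ) → IsIndex Γ λ₁Γ → IsIndex (Γ₁ n) λ₁Γ₁ →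
    λ₁Γ₁ ≤ λ₁Γ →
    ¬ SwitchingEquivalent Γ (Γ₁ n) → HasNegativeC₄ Γ
theorem1 n 5≤n Γ unbalanced λ₁Γ λ₁Γ₁ (eigenvalue , _) index λ₁Γ₁≤λ₁Γ ¬equivalent =
  let r = n ℕ.∸ 5
      n≡5+r = sym (ℕ.m+[n∸m]≡n 5≤n)
      i , 0<i , m*i≡1 = reciprocal (2 ℕ.+ r)
  in large-index n r n≡5+r i 0<i m*i≡1 Γ unbalanced ¬equivalent λ₁Γ eigenvalue
       -- `lower-bound` counts the order as 3 plus its second argument, and 3 + (2 + r) computes to
       -- 5 + r.
       (lower-bound n (2 ℕ.+ r) n≡5+r (2≤nat r) i 0<i m*i≡1 λ₁Γ λ₁Γ₁ index λ₁Γ₁≤λ₁Γ)
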